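{- For every integer $v\ge 19$ we have $$\frac{A_2(v,4;3)}{2^{2v-6}+\left[{v-3\atop 2}\right]_2}\ \ge\ 1.3056.$$
   Context: $A_q(v,d;k)$ denotes the maximum cardinality of a set of $k$-dimensional subspaces of $\mathbb{F}_q^v$ such that any two distinct members $U,W$ satisfy $\mathrm{d}_{\mathrm s}(U,W)\ge d$, where $\mathrm{d}_{\mathrm s}(U,W)=\dim(U)+\dim(W)-2\dim(U\cap W)$. $\left[{a\atop b}\right]_q=\prod_{i=1}^{b}\frac{q^{a-b+i}-1}{q^i-1}$ is the $q$-binomial coefficient. -}

module Defs where

open import Level using (Level; 0ℓ)
open import Algebra.Apartness.Structures using (IsHeytingField)
open import Algebra.Bundles using (CommutativeRing)
import Algebra.Properties.Ring as RingProperties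
open import Data.Bool.Base using (Bool; true; false; _xor_; _∧_)
import Data.Bool.Properties as Bool
open import Data.Fin.Base using (Fin; zero; suc; combine; funToFin; finToFun)
import Data.Fin.Properties as Fin
open import Data.Integer.Base using (+_)
open import Data.List.Base as List using (List; []; _∷_; foldr; applyUpTo)
open import Data.List.Membership.Propositional using () renaming (_∈_ to _∈ˡ_)
open import Data.List.Membership.Propositional.Properties using (∈-tabulate⁺)
open import Data.List.Relation.Unary.Any using (here; there)
open import Data.Nat.Base as ℕ using (ℕ; zero; suc; _+_; _∸_; _*_; _^_; _≤_; _<_; NonZero; NonTrivial; z≤n; s≤s)
import Data.Nat.Properties as ℕ
open import Data.Product.Base using (∃; _×_; _,_; proj₁; proj₂)
open import Data.Rational.Base as ℚ using (ℚ; 1ℚ; _/_)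
import Data.Rational.Properties as ℚ
open import Data.Vec.Base as Vec using (Vec; []; _∷_; lookup; tabulate; replicate; zipWith; map)
import Data.Vec.Properties as Vec
open import Function.Base using (_∘_; id)
open import Function.Bundles using (_↔_; Inverse; Injection; mk↔ₛ′)
open import Function.Properties.Inverse using (↔-sym; ↔⇒↣)
open import Relation.Binary.Definitions using (DecidableEquality)
import Relation.Binary.Properties.DecSetoid as DecSetoidProperties
open import Relation.Binary.PropositionalEquality
open import Relation.Nullary using (¬_; Dec; yes; no; contradiction)
open import Relation.Nullary.Decidable using (map′; ¬?; _→-dec_; _×-dec_)
open import Relation.Unary using (Pred; Decidable; _∈_; _∉_; _⊆_; _≐_)

private
  variable
    a p : Level
    X : Set a

module _ {m : ℕ} (X↔Fin : X ↔ Fin m) where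
  open Inverse X↔Fin

  ∃? : {P : Pred X p} → Decidable P → Dec (∃ P)
  ∃? {P = P} P? = map′ (λ (i , Pi) → from i , Pi)
    (λ (x , Px) → to x , subst P (sym (strictlyInverseʳ x)) Px)
    (Fin.any? (P? ∘ from))

  ∀? : {P : Pred X p} → Decidable P → Dec (∀ x → P x)
  ∀? {P = P} P? = map′ (λ ∀P x → subst P (strictlyInverseʳ x) (∀P (to x)))
    (λ ∀P → ∀P ∘ from) (Fin.all? (P? ∘ from))

  elements : List X
  elements = List.tabulate from

  ∈-elements : ∀ x → x ∈ˡ elements
  ∈-elements x = subst (_∈ˡ elements) (strictlyInverseʳ x) (∈-tabulate⁺ (to x))

  finite⇒≟ : DecidableEquality X
  finite⇒≟ = Fin.inj⇒≟ (↔⇒↣ X↔Fin)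

  Vec↔Fin : ∀ n → Vec X n ↔ Fin (m ^ n)
  Vec↔Fin n = mk↔ₛ′ f g f∘g g∘f
    where
    f : Vec X n → Fin (m ^ n)
    f xs = funToFin (to ∘ lookup xs)

    g : Fin (m ^ n) → Vec X n
    g i = tabulate (from ∘ finToFun i)

    funToFin-cong : ∀ {k l} {h h′ : Fin k → Fin l} → h ≗ h′ → funToFin h ≡ funToFin h′
    funToFin-cong {zero}  _ = refl
    funToFin-cong {suc k} h≗h′ = cong₂ combine (h≗h′ zero) (funToFin-cong (h≗h′ ∘ suc))

    f∘g : ∀ i → f (g i) ≡ i
    f∘g i = trans (funToFin-cong {n} {m} (λ j → trans
        (cong to (Vec.lookup∘tabulate (from ∘ finToFun i) j))
        (strictlyInverseˡ (finToFun i j))))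
      (Fin.funToFin-finToFin {n} {m} i)

    g∘f : ∀ xs → g (f xs) ≡ xs
    g∘f xs = trans (Vec.tabulate-cong (λ j → trans
        (cong from (Fin.finToFun-funToFin (to ∘ lookup xs) j))
        (strictlyInverseʳ (lookup xs j))))
      (Vec.tabulate∘lookup xs)

injective⇒≤ : ∀ {b} {Y : Set b} {m n} → X ↔ Fin m → Y ↔ Fin n →
              (f : X → Y) → (∀ {x y} → f x ≡ f y → x ≡ y) → m ≤ n
injective⇒≤ X↔Fin Y↔Fin f f-inj = Fin.injective⇒≤ {f = Y.to ∘ f ∘ X.from}
  (Injection.injective (↔⇒↣ (↔-sym X↔Fin)) ∘ f-inj ∘ Injection.injective (↔⇒↣ Y↔Fin))
  where
  module X = Inverse X↔Fin
  module Y = Inverse Y↔Fin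

IsMaximum : Pred ℕ p → Pred ℕ p
IsMaximum P m = P m × (∀ {n} → P n → n ≤ m)

maximum : {P : Pred ℕ p} → Decidable P → P 0 → ∀ b → (∀ {n} → P n → n ≤ b) → ∃ (IsMaximum P)
maximum P? P0 zero    P⇒≤b = 0 , P0 , P⇒≤b
maximum P? P0 (suc b) P⇒≤b with P? (suc b)
... | yes Pb = suc b , Pb , P⇒≤b
... | no ¬Pb = maximum P? P0 b λ Pn →
  ℕ.≤-pred (ℕ.≤∧≢⇒< (P⇒≤b Pn) λ { refl → ¬Pb Pn })

-- With _≡_ as equality and _≢_ as apartness, a Heyting field is a
-- discrete field; in particular 0# ≢ 1#.
record FiniteField : Set₁ where
  infixl 6 _+ᶠ_
  infixl 7 _*ᶠ_
  field
    Carrier        : Set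
    _+ᶠ_ _*ᶠ_      : Carrier → Carrier → Carrier
    -ᶠ_            : Carrier → Carrier
    0# 1#          : Carrier
    isHeytingField : IsHeytingField _≡_ _≢_ _+ᶠ_ _*ᶠ_ -ᶠ_ 0# 1#
    order          : ℕ
    enumeration    : Carrier ↔ Fin order

𝔽₂ : FiniteField
𝔽₂ = record
  { Carrier        = Bool
  ; _+ᶠ_           = _xor_
  ; _*ᶠ_           = _∧_
  ; -ᶠ_            = id
  ; 0#             = false
  ; 1#             = true
  ; isHeytingField = record
    { isHeytingCommutativeRing = record
      { isCommutativeRing   = CommutativeRing.isCommutativeRing Bool.xor-∧-commutativeRing
      ; isApartnessRelation = ≉-isApartnessRelation
      ; #⇒invertible        = λ {x} {y} → ≢⇒invertible x y
      ; invertible⇒#        = λ {x} {y} → invertible⇒≢ x y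
      }
    ; tight = ≉-tight
    }
  ; order       = 2
  ; enumeration = ↔-sym Fin.2↔Bool
  }
  where
  open DecSetoidProperties Bool.≡-decSetoid

  ≢⇒invertible : ∀ x y → x ≢ y → ∃ λ z → z ∧ (x xor y) ≡ true × (x xor y) ∧ z ≡ true
  ≢⇒invertible false false x≢y = contradiction refl x≢y
  ≢⇒invertible false true  x≢y = true , refl , refl
  ≢⇒invertible true  false x≢y = true , refl , refl
  ≢⇒invertible true  true  x≢y = contradiction refl x≢y

  invertible⇒≢ : ∀ x y → (∃ λ z → z ∧ (x xor y) ≡ true × (x xor y) ∧ z ≡ true) → x ≢ y
  invertible⇒≢ false .false (_ , _ , ()) refl
  invertible⇒≢ true  .true  (_ , _ , ()) refl

module _ (𝔽 : FiniteField) where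
  open FiniteField 𝔽
  open IsHeytingField isHeytingField
    using (isCommutativeRing; #⇒invertible; invertible⇒#)

  private
    F = Carrier

    commutativeRing : CommutativeRing 0ℓ 0ℓ
    commutativeRing = record { isCommutativeRing = isCommutativeRing }

    module R = CommutativeRing commutativeRing
    open RingProperties R.ring

    _≟_ : ∀ {n} → DecidableEquality (Vec F n)
    _≟_ = Vec.≡-dec (finite⇒≟ enumeration)

    vectors : ∀ n → Vec F n ↔ Fin (order ^ n)
    vectors = Vec↔Fin enumeration

  0ᵛ : ∀ {n} → Vec F n
  0ᵛ = replicate _ 0#

  addᵛ : ∀ {n} → Vec F n → Vec F n → Vec F n
  addᵛ = zipWith _+ᶠ_

  scaleᵛ : ∀ {n} → F → Vec F n → Vec F n
  scaleᵛ c = map (c *ᶠ_)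

  -- Membership is taken decidable: classically every subset of the
  -- finite set Vec F n is, and constructively it makes the dimension
  -- a function of the subspace.
  record Subspace (n : ℕ) : Set₁ where
    field
      ⟦_⟧          : Pred (Vec F n) 0ℓ
      _∈?          : Decidable ⟦_⟧
      0∈           : 0ᵛ ∈ ⟦_⟧
      add-closed   : ∀ {x y} → x ∈ ⟦_⟧ → y ∈ ⟦_⟧ → addᵛ x y ∈ ⟦_⟧
      scale-closed : ∀ c {x} → x ∈ ⟦_⟧ → scaleᵛ c x ∈ ⟦_⟧

  open Subspace

  SameSubspace : ∀ {n} → Subspace n → Subspace n → Set
  SameSubspace U W = ⟦ U ⟧ ≐ ⟦ W ⟧

  intersection : ∀ {n} → Subspace n → Subspace n → Subspace n
  intersection U W = record
    { ⟦_⟧          = λ x → x ∈ ⟦ U ⟧ × x ∈ ⟦ W ⟧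
    ; _∈?          = λ x → (U ∈?) x ×-dec (W ∈?) x
    ; 0∈           = 0∈ U , 0∈ W
    ; add-closed   = λ (xU , xW) (yU , yW) → add-closed U xU yU , add-closed W xW yW
    ; scale-closed = λ c (xU , xW) → scale-closed U c xU , scale-closed W c xW
    }

  combination : ∀ {k n} → Vec F k → Vec (Vec F n) k → Vec F n
  combination []       []       = 0ᵛ
  combination (c ∷ cs) (b ∷ bs) = addᵛ (scaleᵛ c b) (combination cs bs)

  Span : ∀ {k n} → Vec (Vec F n) k → Pred (Vec F n) 0ℓ
  Span bs x = ∃ λ cs → combination cs bs ≡ x

  Independent : ∀ {k n} → Pred (Vec (Vec F n) k) 0ℓ
  Independent bs = ∀ cs → combination cs bs ≡ 0ᵛ → cs ≡ 0ᵛ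

  IsBasis : ∀ {k n} → Subspace n → Pred (Vec (Vec F n) k) 0ℓ
  IsBasis U bs = (∀ i → lookup bs i ∈ ⟦ U ⟧) × Independent bs × ⟦ U ⟧ ⊆ Span bs

  private
    add-0ˡ : ∀ {n} (x : Vec F n) → addᵛ 0ᵛ x ≡ x
    add-0ˡ = Vec.zipWith-identityˡ R.+-identityˡ

    add-0ʳ : ∀ {n} (x : Vec F n) → addᵛ x 0ᵛ ≡ x
    add-0ʳ = Vec.zipWith-identityʳ R.+-identityʳ

    add-assoc : ∀ {n} (x y z : Vec F n) → addᵛ (addᵛ x y) z ≡ addᵛ x (addᵛ y z)
    add-assoc = Vec.zipWith-assoc R.+-assoc

    add-comm : ∀ {n} (x y : Vec F n) → addᵛ x y ≡ addᵛ y x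
    add-comm = Vec.zipWith-comm R.+-comm

    scale-0ˡ : ∀ {n} (x : Vec F n) → scaleᵛ 0# x ≡ 0ᵛ
    scale-0ˡ []      = refl
    scale-0ˡ (a ∷ x) = cong₂ _∷_ (R.zeroˡ a) (scale-0ˡ x)

    scale-0ʳ : ∀ {n} c → scaleᵛ c (0ᵛ {n}) ≡ 0ᵛ
    scale-0ʳ {zero}  c = refl
    scale-0ʳ {suc n} c = cong₂ _∷_ (R.zeroʳ c) (scale-0ʳ c)

    scale-1 : ∀ {n} (x : Vec F n) → scaleᵛ 1# x ≡ x
    scale-1 []      = refl
    scale-1 (a ∷ x) = cong₂ _∷_ (R.*-identityˡ a) (scale-1 x)

    scale-* : ∀ {n} c d (x : Vec F n) → scaleᵛ (c *ᶠ d) x ≡ scaleᵛ c (scaleᵛ d x)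
    scale-* c d []      = refl
    scale-* c d (a ∷ x) = cong₂ _∷_ (R.*-assoc c d a) (scale-* c d x)

    scale-+ : ∀ {n} c d (x : Vec F n) → scaleᵛ (c +ᶠ d) x ≡ addᵛ (scaleᵛ c x) (scaleᵛ d x)
    scale-+ c d []      = refl
    scale-+ c d (a ∷ x) = cong₂ _∷_ (R.distribʳ a c d) (scale-+ c d x)

    scale-add : ∀ {n} c (x y : Vec F n) → scaleᵛ c (addᵛ x y) ≡ addᵛ (scaleᵛ c x) (scaleᵛ c y)
    scale-add c []      []      = refl
    scale-add c (a ∷ x) (b ∷ y) = cong₂ _∷_ (R.distribˡ c a b) (scale-add c x y)

    add-inverse : ∀ {n} (x : Vec F n) → addᵛ x (scaleᵛ (-ᶠ 1#) x) ≡ 0ᵛ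
    add-inverse []      = refl
    add-inverse (a ∷ x) = cong₂ _∷_
      (trans (cong (a +ᶠ_) (-1*x≈-x a)) (R.-‿inverseʳ a)) (add-inverse x)

    add-unique : ∀ {n} (x y : Vec F n) → addᵛ x (scaleᵛ (-ᶠ 1#) y) ≡ 0ᵛ → x ≡ y
    add-unique []      []      _  = refl
    add-unique (a ∷ x) (b ∷ y) eq = cong₂ _∷_
      (x∙y⁻¹≈ε⇒x≈y a b (trans (cong (a +ᶠ_) (sym (-1*x≈-x b))) (Vec.∷-injectiveˡ eq)))
      (add-unique x y (Vec.∷-injectiveʳ eq))

    interchange : ∀ {n} (w x y z : Vec F n) →
                  addᵛ (addᵛ w x) (addᵛ y z) ≡ addᵛ (addᵛ w y) (addᵛ x z)
    interchange w x y z = begin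
      addᵛ (addᵛ w x) (addᵛ y z) ≡⟨ add-assoc w x _ ⟩
      addᵛ w (addᵛ x (addᵛ y z)) ≡⟨ cong (addᵛ w) (add-assoc x y z) ⟨
      addᵛ w (addᵛ (addᵛ x y) z) ≡⟨ cong (λ u → addᵛ w (addᵛ u z)) (add-comm x y) ⟩
      addᵛ w (addᵛ (addᵛ y x) z) ≡⟨ cong (addᵛ w) (add-assoc y x z) ⟩
      addᵛ w (addᵛ y (addᵛ x z)) ≡⟨ add-assoc w y _ ⟨
      addᵛ (addᵛ w y) (addᵛ x z) ∎
      where open ≡-Reasoning

  combination-0 : ∀ {k n} (bs : Vec (Vec F n) k) → combination 0ᵛ bs ≡ 0ᵛ
  combination-0 []       = refl
  combination-0 (b ∷ bs) = trans (cong₂ addᵛ (scale-0ˡ b) (combination-0 bs)) (add-0ˡ 0ᵛ)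

  combination-add : ∀ {k n} cs ds (bs : Vec (Vec F n) k) →
    combination (addᵛ cs ds) bs ≡ addᵛ (combination cs bs) (combination ds bs)
  combination-add []       []       []       = sym (add-0ˡ 0ᵛ)
  combination-add (c ∷ cs) (d ∷ ds) (b ∷ bs) = trans
    (cong₂ addᵛ (scale-+ c d b) (combination-add cs ds bs))
    (interchange (scaleᵛ c b) (scaleᵛ d b) (combination cs bs) (combination ds bs))

  combination-scale : ∀ {k n} a cs (bs : Vec (Vec F n) k) →
    combination (scaleᵛ a cs) bs ≡ scaleᵛ a (combination cs bs)
  combination-scale a []       []       = sym (scale-0ʳ a)
  combination-scale a (c ∷ cs) (b ∷ bs) = trans
    (cong₂ addᵛ (scale-* a c b) (combination-scale a cs bs))
    (sym (scale-add a (scaleᵛ c b) (combination cs bs)))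

  combination-∈ : ∀ {k n} (U : Subspace n) cs (bs : Vec (Vec F n) k) →
    (∀ i → lookup bs i ∈ ⟦ U ⟧) → combination cs bs ∈ ⟦ U ⟧
  combination-∈ U []       []       _    = 0∈ U
  combination-∈ U (c ∷ cs) (b ∷ bs) bs∈U =
    add-closed U (scale-closed U c (bs∈U zero)) (combination-∈ U cs bs (bs∈U ∘ suc))

  combination-injective : ∀ {k n} (bs : Vec (Vec F n) k) → Independent bs →
    ∀ {cs ds} → combination cs bs ≡ combination ds bs → cs ≡ ds
  combination-injective bs ind {cs} {ds} eq = add-unique cs ds (ind _ (begin
    combination (addᵛ cs (scaleᵛ (-ᶠ 1#) ds)) bs                         ≡⟨ combination-add cs _ bs ⟩
    addᵛ (combination cs bs) (combination (scaleᵛ (-ᶠ 1#) ds) bs)        ≡⟨ cong₂ addᵛ eq (combination-scale _ ds bs) ⟩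
    addᵛ (combination ds bs) (scaleᵛ (-ᶠ 1#) (combination ds bs))        ≡⟨ add-inverse (combination ds bs) ⟩
    0ᵛ                                                                   ∎))
    where open ≡-Reasoning

  Span? : ∀ {k n} (bs : Vec (Vec F n) k) → Decidable (Span bs)
  Span? bs x = ∃? (vectors _) (λ cs → combination cs bs ≟ x)

  ∈-Span : ∀ {k n} (bs : Vec (Vec F n) k) i → lookup bs i ∈ Span bs
  ∈-Span (b ∷ bs) zero    = 1# ∷ 0ᵛ ,
    trans (cong₂ addᵛ (scale-1 b) (combination-0 bs)) (add-0ʳ b)
  ∈-Span (b ∷ bs) (suc i) with cs , eq ← ∈-Span bs i = 0# ∷ cs ,
    trans (cong₂ addᵛ (scale-0ˡ b) eq) (add-0ˡ _)

  span : ∀ {k n} → Vec (Vec F n) k → Subspace n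
  span bs = record
    { ⟦_⟧          = Span bs
    ; _∈?          = Span? bs
    ; 0∈           = 0ᵛ , combination-0 bs
    ; add-closed   = λ { (cs , refl) (ds , refl) → addᵛ cs ds , combination-add cs ds bs }
    ; scale-closed = λ { c (cs , refl) → scaleᵛ c cs , combination-scale c cs bs }
    }

  span-basis : ∀ {k n} {bs : Vec (Vec F n) k} → Independent bs → IsBasis (span bs) bs
  span-basis {bs = bs} ind = ∈-Span bs , ind , id

  basis⇒≐ : ∀ {k n} (U : Subspace n) {bs : Vec (Vec F n) k} → IsBasis U bs → SameSubspace U (span bs)
  basis⇒≐ U {bs} (bs∈U , _ , spans) = spans , λ { (cs , refl) → combination-∈ U cs bs bs∈U }

  IsBasis-resp-≐ : ∀ {k n} (U W : Subspace n) → SameSubspace U W →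
                   {bs : Vec (Vec F n) k} → IsBasis U bs → IsBasis W bs
  IsBasis-resp-≐ U W (U⊆W , W⊆U) (bs∈U , ind , spans) = U⊆W ∘ bs∈U , ind , spans ∘ W⊆U

  independent-∷ : ∀ {k n} {x} {bs : Vec (Vec F n) k} → Independent bs → x ∉ Span bs → Independent (x ∷ bs)
  independent-∷ {x = x} {bs} ind x∉ (c ∷ cs) eq with finite⇒≟ enumeration c 0#
  ... | yes refl = cong (0# ∷_) (ind cs (trans (sym (add-0ˡ _))
                     (trans (cong (λ u → addᵛ u (combination cs bs)) (sym (scale-0ˡ x))) eq)))
  ... | no  c≢0 with #⇒invertible c≢0
  ...   | c⁻¹ , inverse , _ = contradiction
            (scaleᵛ (-ᶠ c⁻¹) cs , trans (combination-scale (-ᶠ c⁻¹) cs bs) (isolate x (combination cs bs) eq)) x∉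
    where
    open ≡-Reasoning

    c⁻¹*c : c⁻¹ *ᶠ c ≡ 1#
    c⁻¹*c = trans (cong (c⁻¹ *ᶠ_) (sym (trans (cong (c +ᶠ_) -0#≈0#) (R.+-identityʳ c)))) inverse

    isolate₁ : ∀ y z → c *ᶠ y +ᶠ z ≡ 0# → (-ᶠ c⁻¹) *ᶠ z ≡ y
    isolate₁ y z eq = begin
      (-ᶠ c⁻¹) *ᶠ z               ≡⟨ cong ((-ᶠ c⁻¹) *ᶠ_) (+-inverseʳ-unique _ _ eq) ⟩
      (-ᶠ c⁻¹) *ᶠ (-ᶠ (c *ᶠ y))   ≡⟨ -‿distribˡ-* c⁻¹ _ ⟨
      -ᶠ (c⁻¹ *ᶠ (-ᶠ (c *ᶠ y)))   ≡⟨ cong -ᶠ_ (-‿distribʳ-* c⁻¹ _) ⟨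
      -ᶠ (-ᶠ (c⁻¹ *ᶠ (c *ᶠ y)))   ≡⟨ -‿involutive _ ⟩
      c⁻¹ *ᶠ (c *ᶠ y)             ≡⟨ R.*-assoc c⁻¹ c y ⟨
      c⁻¹ *ᶠ c *ᶠ y               ≡⟨ cong (_*ᶠ y) c⁻¹*c ⟩
      1# *ᶠ y                     ≡⟨ R.*-identityˡ y ⟩
      y                           ∎

    isolate : ∀ {n} (y z : Vec F n) → addᵛ (scaleᵛ c y) z ≡ 0ᵛ → scaleᵛ (-ᶠ c⁻¹) z ≡ y
    isolate []      []      _  = refl
    isolate (a ∷ y) (b ∷ z) eq = cong₂ _∷_
      (isolate₁ a b (Vec.∷-injectiveˡ eq)) (isolate y z (Vec.∷-injectiveʳ eq))

  private
    extend : ∀ {n} (U : Subspace n) (xs : List (Vec F n)) → ∃ λ k → ∃ λ (bs : Vec (Vec F n) k) →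
      (∀ i → lookup bs i ∈ ⟦ U ⟧) × Independent bs × (∀ {x} → x ∈ˡ xs → x ∈ ⟦ U ⟧ → x ∈ Span bs)
    extend U [] = 0 , [] , (λ ()) , (λ { [] _ → refl }) , λ ()
    extend U (x ∷ xs) with k , bs , bs∈U , ind , spans ← extend U xs | (U ∈?) x
    ... | no  x∉U = k , bs , bs∈U , ind , λ where
          (here refl)  x∈U → contradiction x∈U x∉U
          (there y∈xs) y∈U → spans y∈xs y∈U
    ... | yes x∈U with Span? bs x
    ...   | yes x∈bs = k , bs , bs∈U , ind , λ where
            (here refl)  _   → x∈bs
            (there y∈xs) y∈U → spans y∈xs y∈U
    ...   | no  x∉bs = suc k , x ∷ bs , (λ { zero → x∈U ; (suc i) → bs∈U i }) , independent-∷ ind x∉bs , λ where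
            (here refl)  _   → ∈-Span (x ∷ bs) zero
            (there y∈xs) y∈U → let cs , eq = spans y∈xs y∈U in
              0# ∷ cs , trans (cong₂ addᵛ (scale-0ˡ x) eq) (add-0ˡ _)

  basis-exists : ∀ {n} (U : Subspace n) → ∃ λ k → ∃ λ (bs : Vec (Vec F n) k) → IsBasis U bs
  basis-exists {n} U with k , bs , bs∈U , ind , spans ← extend U (elements (vectors n)) =
    k , bs , bs∈U , ind , λ {x} → spans (∈-elements (vectors n) x)

  dim : ∀ {n} → Subspace n → ℕ
  dim U = proj₁ (basis-exists U)

  private
    1<order : 1 < order
    1<order = injective⇒≤ (↔-sym Fin.2↔Bool) enumeration f f-injective
      where
      f : Bool → F
      f false = 0#
      f true  = 1#

      1≢0 : 1# ≢ 0#
      1≢0 = invertible⇒# (1# , trans (R.*-identityˡ _) 1-0≡1 , trans (R.*-identityʳ _) 1-0≡1)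
        where
        1-0≡1 : 1# +ᶠ (-ᶠ 0#) ≡ 1#
        1-0≡1 = trans (cong (1# +ᶠ_) -0#≈0#) (R.+-identityʳ 1#)

      f-injective : ∀ {x y} → f x ≡ f y → x ≡ y
      f-injective {false} {false} _  = refl
      f-injective {false} {true}  eq = contradiction (sym eq) 1≢0
      f-injective {true}  {false} eq = contradiction eq 1≢0
      f-injective {true}  {true}  _  = refl

    basis-≤ : ∀ {n k l} (U : Subspace n) {bs : Vec (Vec F n) k} {ds : Vec (Vec F n) l} →
              IsBasis U bs → IsBasis U ds → k ≤ l
    basis-≤ {n} {k} {l} U {bs} {ds} (bs∈U , ind , _) (_ , _ , spans) =
      ℕ.≮⇒≥ λ l<k → ℕ.<⇒≱ (ℕ.^-monoʳ-< order 1<order l<k)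
        (injective⇒≤ (vectors k) (vectors l) (proj₁ ∘ coordinates) λ {cs} {es} eq →
          combination-injective bs ind (begin
            combination cs bs                         ≡⟨ proj₂ (coordinates cs) ⟨
            combination (proj₁ (coordinates cs)) ds   ≡⟨ cong (λ u → combination u ds) eq ⟩
            combination (proj₁ (coordinates es)) ds   ≡⟨ proj₂ (coordinates es) ⟩
            combination es bs                         ∎))
      where
      open ≡-Reasoning

      coordinates : ∀ cs → Span ds (combination cs bs)
      coordinates cs = spans (combination-∈ U cs bs bs∈U)

  dim-unique : ∀ {n k} (U : Subspace n) {bs : Vec (Vec F n) k} → IsBasis U bs → dim U ≡ k
  dim-unique U basis = ℕ.≤-antisym (basis-≤ U basisᵁ basis) (basis-≤ U basis basisᵁ)
    where basisᵁ = proj₂ (proj₂ (basis-exists U))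

  dim-cong : ∀ {n} (U W : Subspace n) → SameSubspace U W → dim U ≡ dim W
  dim-cong U W U≐W = sym (dim-unique W (IsBasis-resp-≐ U W U≐W (proj₂ (proj₂ (basis-exists U)))))

  -- The truncated subtraction is exact, as U ∩ W is contained in both
  -- U and W.
  dₛ : ∀ {n} → Subspace n → Subspace n → ℕ
  dₛ U W = (dim U + dim W) ∸ 2 * dim (intersection U W)

  -- Sets of N subspaces are given as injective families; equality of
  -- subspaces is extensional.
  record Code (v d k N : ℕ) : Set₁ where
    field
      codeword  : Fin N → Subspace v
      injective : ∀ {i j} → SameSubspace (codeword i) (codeword j) → i ≡ j
      dimension : ∀ i → dim (codeword i) ≡ k
      distance  : ∀ {i j} → i ≢ j → d ≤ dₛ (codeword i) (codeword j)

  private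
    dₛ-cong : ∀ {n} (U U′ W W′ : Subspace n) → SameSubspace U U′ → SameSubspace W W′ →
              dₛ U W ≡ dₛ U′ W′
    dₛ-cong U U′ W W′ U≐ W≐ = cong₂ _∸_
      (cong₂ _+_ (dim-cong U U′ U≐) (dim-cong W W′ W≐))
      (cong (2 *_) (dim-cong (intersection U W) (intersection U′ W′)
        ( (λ (xU , xW) → proj₁ U≐ xU , proj₁ W≐ xW)
        , (λ (xU , xW) → proj₂ U≐ xU , proj₂ W≐ xW))))

    ≐-trans : ∀ {n} (U V W : Subspace n) → SameSubspace U V → SameSubspace V W → SameSubspace U W
    ≐-trans U V W (f , f′) (g , g′) = g ∘ f , f′ ∘ g′

    ≐-sym : ∀ {n} (U W : Subspace n) → SameSubspace U W → SameSubspace W U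
    ≐-sym U W (f , f′) = f′ , f

    _≐?_ : ∀ {n} (U W : Subspace n) → Dec (SameSubspace U W)
    U ≐? W = (U ⊆? W) ×-dec (W ⊆? U)
      where
      _⊆?_ : ∀ {n} (U W : Subspace n) → Dec (⟦ U ⟧ ⊆ ⟦ W ⟧)
      U ⊆? W = map′ (λ f {x} → f x) (λ f x → f {x})
        (∀? (vectors _) λ x → (U ∈?) x →-dec (W ∈?) x)

    module _ (v d k : ℕ) where
      Bases : ℕ → Set
      Bases N = Vec (Vec (Vec F v) k) N

      GoodBases : ∀ {N} → Bases N → Set
      GoodBases Bs =
        (∀ i → Independent (lookup Bs i)) ×
        (∀ i j → i ≢ j → ¬ SameSubspace (span (lookup Bs i)) (span (lookup Bs j))
                       × d ≤ dₛ (span (lookup Bs i)) (span (lookup Bs j)))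

      GoodBases? : ∀ {N} → Decidable (GoodBases {N})
      GoodBases? Bs =
        Fin.all? (λ i → ∀? (vectors k) λ cs →
          (combination cs (lookup Bs i) ≟ 0ᵛ) →-dec (cs ≟ 0ᵛ))
        ×-dec
        Fin.all? (λ i → Fin.all? λ j → ¬? (i Fin.≟ j) →-dec
          (¬? (span (lookup Bs i) ≐? span (lookup Bs j)) ×-dec (d ℕ.≤? dₛ (span (lookup Bs i)) (span (lookup Bs j)))))

      goodBases⇒code : ∀ {N} → ∃ (GoodBases {N}) → Code v d k N
      goodBases⇒code (Bs , ind , apart) = record
        { codeword  = λ i → span (lookup Bs i)
        ; injective = λ {i} {j} eq → inj i j eq
        ; dimension = λ i → dim-unique (span (lookup Bs i)) (span-basis (ind i))
        ; distance  = λ {i} {j} i≢j → proj₂ (apart i j i≢j)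
        }
        where
        inj : ∀ i j → SameSubspace (span (lookup Bs i)) (span (lookup Bs j)) → i ≡ j
        inj i j eq with i Fin.≟ j
        ... | yes i≡j = i≡j
        ... | no  i≢j = contradiction eq (proj₁ (apart i j i≢j))

      module _ {N : ℕ} (C : Code v d k N) where
        open Code C

        basis : ∀ i → ∃ λ (bs : Vec (Vec F v) k) → IsBasis (codeword i) bs
        basis i = subst (λ l → ∃ λ (bs : Vec (Vec F v) l) → IsBasis (codeword i) bs)
          (dimension i) (proj₂ (basis-exists (codeword i)))

        codeword≐ : ∀ i → SameSubspace (codeword i) (span (proj₁ (basis i)))
        codeword≐ i = basis⇒≐ (codeword i) (proj₂ (basis i))

        basis-injective : ∀ {i j} → SameSubspace (span (proj₁ (basis i))) (span (proj₁ (basis j))) → i ≡ j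
        basis-injective {i} {j} eq = injective
          (≐-trans (codeword i) (span (proj₁ (basis i))) (codeword j) (codeword≐ i)
          (≐-trans (span (proj₁ (basis i))) (span (proj₁ (basis j))) (codeword j) eq
          (≐-sym (codeword j) (span (proj₁ (basis j))) (codeword≐ j))))

        code⇒goodBases : ∃ (GoodBases {N})
        code⇒goodBases = tabulate (proj₁ ∘ basis) , ind , apart
          where
          ind : ∀ i → Independent (lookup (tabulate (proj₁ ∘ basis)) i)
          ind i rewrite Vec.lookup∘tabulate (proj₁ ∘ basis) i = proj₁ (proj₂ (proj₂ (basis i)))

          apart : ∀ i j → i ≢ j →
            let U = span (lookup (tabulate (proj₁ ∘ basis)) i)
                W = span (lookup (tabulate (proj₁ ∘ basis)) j)
            in ¬ SameSubspace U W × d ≤ dₛ U W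
          apart i j i≢j rewrite Vec.lookup∘tabulate (proj₁ ∘ basis) i
                              | Vec.lookup∘tabulate (proj₁ ∘ basis) j =
            i≢j ∘ basis-injective ,
            subst (d ≤_) (dₛ-cong (codeword i) _ (codeword j) _ (codeword≐ i) (codeword≐ j)) (distance i≢j)

        code-≤ : N ≤ (order ^ v) ^ k
        code-≤ = injective⇒≤ (mk↔ₛ′ id id (λ _ → refl) (λ _ → refl)) (Vec↔Fin (vectors v) k) (proj₁ ∘ basis)
          λ eq → basis-injective (subst (λ bs → SameSubspace (span _) (span bs)) eq (id , id))

      emptyCode : Code v d k 0
      emptyCode = record
        { codeword  = λ ()
        ; injective = λ { {()} }
        ; dimension = λ ()
        ; distance  = λ { {()} }
        }

  maximal-code-size : ∀ v d k → ∃ (IsMaximum (Code v d k))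
  maximal-code-size v d k = maximum
    (λ N → map′ (goodBases⇒code v d k) (code⇒goodBases v d k)
      (∃? (Vec↔Fin (Vec↔Fin (vectors v) k) N) (GoodBases? v d k)))
    (emptyCode v d k) ((order ^ v) ^ k) (code-≤ v d k)

  A : (v d k : ℕ) → ℕ
  A v d k = proj₁ (maximal-code-size v d k)

  A-isMaximum : ∀ v d k → IsMaximum (Code v d k) (A v d k)
  A-isMaximum v d k = proj₂ (maximal-code-size v d k)

module _ (q : ℕ) .{{_ : NonTrivial q}} where

  q^1+n∸1≢0 : ∀ n → NonZero (q ^ suc n ∸ 1)
  q^1+n∸1≢0 n = ℕ.>-nonZero (ℕ.m<n⇒0<n∸m (ℕ.^-monoʳ-< q (ℕ.nonTrivial⇒n>1 q) {0} {suc n} (s≤s z≤n)))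

  -- The exponent a - b + i is computed as (a + i) ∸ b, which for
  -- b > a still makes the factor with a - b + i = 0 vanish.
  qBinomialFactor : (a b i : ℕ) .{{_ : NonZero i}} → ℚ
  qBinomialFactor a b i@(suc n) =
    _/_ (+ (q ^ ((a + i) ∸ b) ∸ 1)) (q ^ i ∸ 1) {{q^1+n∸1≢0 n}}

  qBinomial : ℕ → ℕ → ℚ
  qBinomial a b = foldr ℚ._*_ 1ℚ (applyUpTo (λ n → qBinomialFactor a b (suc n)) b)

  qBinomial-nonNegative : ∀ a b → ℚ.NonNegative (qBinomial a b)
  qBinomial-nonNegative a b = product (λ n → qBinomialFactor a b (suc n))
    (λ n → ℚ.normalize-nonNeg (q ^ ((a + suc n) ∸ b) ∸ 1) (q ^ suc n ∸ 1) {{q^1+n∸1≢0 n}}) b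
    where
    product : ∀ f → (∀ n → ℚ.NonNegative (f n)) → ∀ m → ℚ.NonNegative (foldr ℚ._*_ 1ℚ (applyUpTo f m))
    product f f≥0 zero    = _
    product f f≥0 (suc m) = ℚ.nonNeg*nonNeg⇒nonNeg (f 0) {{f≥0 0}} (foldr ℚ._*_ 1ℚ (applyUpTo (f ∘ suc) m)) {{product (f ∘ suc) (f≥0 ∘ suc) m}}

denominator-nonZero : ∀ v → ℚ.NonZero ((+ (2 ^ (2 * v ∸ 6))) / 1 ℚ.+ qBinomial 2 (v ∸ 3) 2)
denominator-nonZero v = ℚ.pos⇒nonZero ((+ (2 ^ (2 * v ∸ 6))) / 1 ℚ.+ qBinomial 2 (v ∸ 3) 2) {{ℚ.pos+nonNeg⇒pos
  ((+ (2 ^ (2 * v ∸ 6))) / 1)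
  {{ℚ.normalize-pos (2 ^ (2 * v ∸ 6)) 1 {{_}} {{ℕ.m^n≢0 2 (2 * v ∸ 6)}}}}
  (qBinomial 2 (v ∸ 3) 2) {{qBinomial-nonNegative 2 (v ∸ 3) 2}}}}

{-# OPTIONS --safe #-}

-- A 2-(13,3,1) Steiner system over 𝔽₂ (Braun, Etzion, Östergård, Vardy,
-- Wassermann) consists of 1597245 planes of 𝔽₂¹³ covering every line
-- exactly once. Lifting it with the matrices of a rank metric code, i.e.
-- replacing a plane with basis matrix B by the planes with basis matrix
-- (B | M), where any two of the 4ⁿ matrices M of size 3 × n differ by a
-- matrix of rank at least two, gives 1597245 · 4ⁿ planes of 𝔽₂¹³⁺ⁿ, any two
-- of which meet in at most a point. Already this part of the known codes
-- has density 1597245 · 3 / (7 · 2¹⁹) = 1.30564….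
--
-- The Steiner system is invariant under the normalizer of a Singer cycle.
-- With nonzero vectors of 𝔽₂¹³ written as powers of a primitive element,
-- the plane with exponents E is moved to 2^φ E + i, so no line is covered
-- twice iff the 8190 differences 2^φ (a - b) of exponents in the 15 orbit
-- representatives are distinct modulo 8191.

module Submission where

open import Algebra.Bundles using (CommutativeRing)
import Algebra.Properties.CommutativeSemigroup as CommutativeSemigroup
open import Data.Bool.Base using (Bool; true; false; if_then_else_)
import Data.Bool.Properties as Bool
open import Data.Fin.Base using (Fin; zero; suc; toℕ)
import Data.Fin.Properties as Fin
open import Data.Integer.Base as ℤ using (+_)
import Data.Integer.Properties as ℤ
open import Data.List.Base using (List; allFin; cartesianProduct; filter; foldr)
open import Data.List.Membership.Propositional using () renaming (_∈_ to _∈ˡ_)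
open import Data.List.Membership.Propositional.Properties using (∈-cartesianProduct⁺; ∈-allFin; ∈-filter⁺)
open import Data.List.Relation.Unary.All as All using (All)
open import Data.Nat.Base as ℕ using (ℕ; zero; suc; _+_; _*_; _∸_; _^_; _%_; _≡ᵇ_; _≤_; z≤n; s≤s)
import Data.Nat.Properties as ℕ
open import Data.Nat.Coprimality using (Coprime; coprime-Bézout; prime⇒coprime)
open import Data.Nat.Divisibility using (_∣_; m%n≡0⇒n∣m)
open import Data.Nat.DivMod using (m≡m%n+[m/n]*n; m%n<n; m<n⇒m%n≡m; %-remove-+ʳ)
open import Data.Nat.GCD using (module Bézout)
open import Data.Nat.Primality using (Prime; prime?)
open import Data.Nat.Solver using (module +-*-Solver)
open import Data.Product.Base using (∃; _×_; _,_; proj₁; proj₂)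
open import Data.Product.Function.NonDependent.Propositional using (_×-↔_)
open import Data.Product.Properties using (≡-dec)
open import Data.Rational.Base as ℚ using (ℚ; 1ℚ; _/_; _÷_; toℚᵘ)
import Data.Rational.Properties as ℚ
open import Data.Rational.Unnormalised.Base as ℚᵘ using (mkℚᵘ; *≤*)
import Data.Rational.Unnormalised.Properties as ℚᵘ
open import Data.Sum.Base using (inj₁; inj₂)
open import Data.Vec.Base using (Vec; []; _∷_; _++_; _∷ʳ_; iterate; lookup; map; replicate; zipWith)
import Data.Vec.Properties as Vec
open import Function.Base using (_∘_; _∋_)
open import Function.Bundles using (_↔_; Inverse; Injection)
open import Function.Properties.Inverse using (↔-refl; ↔-sym; ↔-trans; ↔⇒↣)
open import Relation.Binary.Definitions using (DecidableEquality)
open import Relation.Binary.PropositionalEquality hiding (J)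
open import Relation.Nullary using (¬_; Dec; contradiction)
open import Relation.Nullary.Decidable
  using (map′; ¬?; decidable-stable; from-yes; toWitness; toWitnessFalse; _×-dec_; _→-dec_)
open import Relation.Unary using (Decidable; _∈_)
open import Defs
open +-*-Solver using (solve; _:=_; _:+_; _:*_; con)

-- Packings, rank metric codes and subspace codes over a finite field.

module _ (𝔽 : FiniteField) where
  open FiniteField 𝔽
  open Subspace

  private
    variable
      k l m n N : ℕ
      I J : Set

  -- Associativity (c A) B = c (A B) of the matrix product, with vectors as rows acted on from the
  -- right.
  combination-combination : ∀ (c : Vec Carrier k) (as : Vec (Vec Carrier l) k) (bs : Vec (Vec Carrier n) l) →
    combination 𝔽 (combination 𝔽 c as) bs ≡ combination 𝔽 c (map (λ a → combination 𝔽 a bs) as)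
  combination-combination []      []       bs = combination-0 𝔽 bs
  combination-combination (x ∷ c) (a ∷ as) bs = trans
    (combination-add 𝔽 (scaleᵛ 𝔽 x a) (combination 𝔽 c as) bs)
    (cong₂ (addᵛ 𝔽) (combination-scale 𝔽 x a bs) (combination-combination c as bs))

  independent-map⁺ : ∀ {as : Vec (Vec Carrier l) k} {bs : Vec (Vec Carrier n) l} →
    Independent 𝔽 bs → Independent 𝔽 as → Independent 𝔽 (map (λ a → combination 𝔽 a bs) as)
  independent-map⁺ {as = as} {bs} bs-ind as-ind c eq =
    as-ind c (bs-ind _ (trans (combination-combination c as bs) eq))

  independent-map⁻ : ∀ {as : Vec (Vec Carrier l) k} {bs : Vec (Vec Carrier n) l} →
    Independent 𝔽 (map (λ a → combination 𝔽 a bs) as) → Independent 𝔽 as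
  independent-map⁻ {as = as} {bs} ind c eq = ind c (begin
    combination 𝔽 c (map (λ a → combination 𝔽 a bs) as) ≡⟨ combination-combination c as bs ⟨
    combination 𝔽 (combination 𝔽 c as) bs               ≡⟨ cong (λ u → combination 𝔽 u bs) eq ⟩
    combination 𝔽 (0ᵛ 𝔽) bs                             ≡⟨ combination-0 𝔽 bs ⟩
    0ᵛ 𝔽                                                ∎)
    where open ≡-Reasoning

  independent-prefix : ∀ {x y} {bs : Vec (Vec Carrier n) k} →
    Independent 𝔽 (x ∷ y ∷ bs) → Independent 𝔽 (x ∷ y ∷ [])
  independent-prefix {x = x} {y} {bs} ind (a ∷ b ∷ []) eq
    with ind (a ∷ b ∷ 0ᵛ 𝔽) (trans (cong (λ u → addᵛ 𝔽 (scaleᵛ 𝔽 a x) (addᵛ 𝔽 (scaleᵛ 𝔽 b y) u))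
                              (combination-0 𝔽 bs)) eq)
  ... | refl = refl

  combination-++ : ∀ (c : Vec Carrier k) (as : Vec (Vec Carrier m) k) (bs : Vec (Vec Carrier n) k) →
    combination 𝔽 c (zipWith _++_ as bs) ≡ combination 𝔽 c as ++ combination 𝔽 c bs
  combination-++ {m = m} [] [] [] = 0-++ m
    where
    0-++ : ∀ m {n} → 0ᵛ 𝔽 {m + n} ≡ 0ᵛ 𝔽 {m} ++ 0ᵛ 𝔽 {n}
    0-++ zero    = refl
    0-++ (suc m) = cong (0# ∷_) (0-++ m)
  combination-++ (x ∷ c) (a ∷ as) (b ∷ bs) = begin
    addᵛ 𝔽 (scaleᵛ 𝔽 x (a ++ b)) (combination 𝔽 c (zipWith _++_ as bs))
      ≡⟨ cong₂ (addᵛ 𝔽) (Vec.map-++ (x *ᶠ_) a b) (combination-++ c as bs) ⟩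
    addᵛ 𝔽 (scaleᵛ 𝔽 x a ++ scaleᵛ 𝔽 x b) (combination 𝔽 c as ++ combination 𝔽 c bs)
      ≡⟨ Vec.zipWith-++ _+ᶠ_ (scaleᵛ 𝔽 x a) _ _ _ ⟩
    combination 𝔽 (x ∷ c) (a ∷ as) ++ combination 𝔽 (x ∷ c) (b ∷ bs) ∎
    where open ≡-Reasoning

  -- In coordinates: the row spaces at distinct indices meet in at most a point.
  IsPacking : (I → Vec (Vec Carrier n) k) → Set
  IsPacking B =
    (∀ i → Independent 𝔽 (B i)) ×
    (∀ {i j} c d c′ d′ → Independent 𝔽 (c ∷ d ∷ []) →
      combination 𝔽 c (B i) ≡ combination 𝔽 c′ (B j) →
      combination 𝔽 d (B i) ≡ combination 𝔽 d′ (B j) → i ≡ j)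

  -- The left kernel of the difference of two matrices is at most one-dimensional.
  IsRankCode : (I → Vec (Vec Carrier n) k) → Set
  IsRankCode R = ∀ {i j} c d → Independent 𝔽 (c ∷ d ∷ []) →
    combination 𝔽 c (R i) ≡ combination 𝔽 c (R j) →
    combination 𝔽 d (R i) ≡ combination 𝔽 d (R j) → i ≡ j

  juxtapose : (I → Vec (Vec Carrier m) k) → (J → Vec (Vec Carrier n) k) →
              I × J → Vec (Vec Carrier (m + n)) k
  juxtapose B R (i , j) = zipWith _++_ (B i) (R j)

  module _ (B : I → Vec (Vec Carrier m) k) (R : J → Vec (Vec Carrier n) k) where

    private
      split : ∀ {i j i′ j′} c c′ →
        combination 𝔽 c (juxtapose B R (i , j)) ≡ combination 𝔽 c′ (juxtapose B R (i′ , j′)) →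
        combination 𝔽 c (B i) ≡ combination 𝔽 c′ (B i′) × combination 𝔽 c (R j) ≡ combination 𝔽 c′ (R j′)
      split {i} {j} {i′} {j′} c c′ eq = Vec.++-injective _ _ (begin
        combination 𝔽 c (B i) ++ combination 𝔽 c (R j)         ≡⟨ combination-++ c (B i) (R j) ⟨
        combination 𝔽 c (juxtapose B R (i , j))                ≡⟨ eq ⟩
        combination 𝔽 c′ (juxtapose B R (i′ , j′))             ≡⟨ combination-++ c′ (B i′) (R j′) ⟩
        combination 𝔽 c′ (B i′) ++ combination 𝔽 c′ (R j′)     ∎)
        where open ≡-Reasoning

    -- A left kernel vector of a difference of juxtaposed matrices is one for both halves, so each
    -- half determines its own index.
    juxtapose-isRankCode : IsRankCode B → IsRankCode R → IsRankCode (juxtapose B R)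
    juxtapose-isRankCode B-sep R-sep c d ind eqᶜ eqᵈ =
      let eqᶜ₁ , eqᶜ₂ = split c c eqᶜ
          eqᵈ₁ , eqᵈ₂ = split d d eqᵈ
      in cong₂ _,_ (B-sep c d ind eqᶜ₁ eqᵈ₁) (R-sep c d ind eqᶜ₂ eqᵈ₂)

    -- A line common to two lifted spaces projects to a line common to the left halves, which
    -- therefore coincide. The right halves then differ by a matrix whose left kernel contains two
    -- independent vectors.
    juxtapose-isPacking : IsPacking B → IsRankCode R → IsPacking (juxtapose B R)
    juxtapose-isPacking (B-ind , B-sep) R-sep = independent , separated
      where
      independent : ∀ ij → Independent 𝔽 (juxtapose B R ij)
      independent ij@(i , j) c eq = combination-injective 𝔽 (B i) (B-ind i)
        (proj₁ (split {j = j} {j′ = j} c (0ᵛ 𝔽) (trans eq (sym (combination-0 𝔽 (juxtapose B R ij))))))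

      separated : ∀ {ij ij′} c d c′ d′ → Independent 𝔽 (c ∷ d ∷ []) →
        combination 𝔽 c (juxtapose B R ij) ≡ combination 𝔽 c′ (juxtapose B R ij′) →
        combination 𝔽 d (juxtapose B R ij) ≡ combination 𝔽 d′ (juxtapose B R ij′) → ij ≡ ij′
      separated {i , j} {i′ , j′} c d c′ d′ ind eqᶜ eqᵈ
        with eqᶜ₁ , eqᶜ₂ ← split c c′ eqᶜ
           | eqᵈ₁ , eqᵈ₂ ← split d d′ eqᵈ
        with refl ← B-sep c d c′ d′ ind eqᶜ₁ eqᵈ₁
        -- The rows of `B i` are independent, so both sides use the same coordinates and the right
        -- halves are compared at the same `c` and `d`.
        with refl ← combination-injective 𝔽 (B i) (B-ind i) {c} {c′} eqᶜ₁
           | refl ← combination-injective 𝔽 (B i) (B-ind i) {d} {d′} eqᵈ₁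
        = cong (i ,_) (R-sep c d ind eqᶜ₂ eqᵈ₂)

  dim≤1 : ∀ (U : Subspace 𝔽 n) →
    (∀ {x y} → Independent 𝔽 (x ∷ y ∷ []) → x ∈ ⟦ U ⟧ → ¬ y ∈ ⟦ U ⟧) → dim 𝔽 U ≤ 1
  dim≤1 {n} U ¬line = go (basis-exists 𝔽 U)
    where
    go : (basis : ∃ λ k → ∃ λ (bs : Vec (Vec Carrier n) k) → IsBasis 𝔽 U bs) → proj₁ basis ≤ 1
    go (0 , _)                                = z≤n
    go (1 , _)                                = s≤s z≤n
    go (suc (suc _) , x ∷ y ∷ bs , bs∈U , ind , _) =
      contradiction (bs∈U (suc zero)) (¬line (independent-prefix ind) (bs∈U zero))

  -- Intersections have dimension at most one, so the distance is at least the sum of the dimensions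
  -- minus 2. Dimension at least two makes equal spaces share a line, which gives injectivity.
  packing⇒code : {B : I → Vec (Vec Carrier n) (2 + k)} → I ↔ Fin N → IsPacking B →
                 Code 𝔽 n ((2 + k + (2 + k)) ∸ 2) (2 + k) N
  packing⇒code {n = n} {k = k} {N = N} {B = B} I↔Fin (ind , sep) = record
    { codeword  = codeword
    ; injective = λ {i} {j} (U⊆W , _) → injective i j U⊆W
    ; dimension = dimension
    ; distance  = distance
    }
    where
    open Inverse I↔Fin using (from)

    codeword : Fin N → Subspace 𝔽 n
    codeword = span 𝔽 ∘ B ∘ from

    dimension : ∀ i → dim 𝔽 (codeword i) ≡ 2 + k
    dimension i = dim-unique 𝔽 (codeword i) (span-basis 𝔽 (ind (from i)))

    separated : ∀ i j {x y} → Independent 𝔽 (x ∷ y ∷ []) →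
      x ∈ Span 𝔽 (B (from i)) → y ∈ Span 𝔽 (B (from i)) →
      x ∈ Span 𝔽 (B (from j)) → y ∈ Span 𝔽 (B (from j)) → i ≡ j
    separated i j xy-ind (c , refl) (d , refl) (c′ , eqᶜ) (d′ , eqᵈ) =
      Injection.injective (↔⇒↣ (↔-sym I↔Fin))
        (sep c d c′ d′ (independent-map⁻ xy-ind) (sym eqᶜ) (sym eqᵈ))

    injective : ∀ i j → (∀ {x} → x ∈ Span 𝔽 (B (from i)) → x ∈ Span 𝔽 (B (from j))) → i ≡ j
    -- Matching exposes two independent basis vectors, which lie in both spaces.
    injective i j U⊆W with B (from i) | ind (from i) | separated i j
    ... | x ∷ y ∷ bs | ind-i | sep-ij = sep-ij (independent-prefix ind-i)
      (∈-Span 𝔽 (x ∷ y ∷ bs) zero) (∈-Span 𝔽 (x ∷ y ∷ bs) (suc zero))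
      (U⊆W (∈-Span 𝔽 (x ∷ y ∷ bs) zero)) (U⊆W (∈-Span 𝔽 (x ∷ y ∷ bs) (suc zero)))

    distance : ∀ {i j} → i ≢ j → (2 + k + (2 + k)) ∸ 2 ≤ dₛ 𝔽 (codeword i) (codeword j)
    distance {i} {j} i≢j = ℕ.∸-mono
      (ℕ.≤-reflexive (sym (cong₂ _+_ (dimension i) (dimension j))))
      (ℕ.*-monoʳ-≤ 2 (dim≤1 (intersection 𝔽 (codeword i) (codeword j))
        λ ind (xU , xW) (yU , yW) → i≢j (separated i j ind xU yU xW yW)))

-- Linear algebra over 𝔽₂.

private
  variable
    k m n : ℕ

infix  4 _≟_
infixl 6 _⊕_
infixl 7 _·_

_⊕_ : Vec Bool n → Vec Bool n → Vec Bool n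
_⊕_ = addᵛ 𝔽₂

_·_ : Vec Bool k → Vec (Vec Bool n) k → Vec Bool n
_·_ = combination 𝔽₂

𝟎 : Vec Bool n
𝟎 = 0ᵛ 𝔽₂

_≟_ : DecidableEquality (Vec Bool n)
_≟_ = Vec.≡-dec Bool._≟_

-- Recursion on the bits, without a detour through an enumeration by `Fin`, for the finite checks
-- below.
Π? : ∀ {n} {P : Vec Bool n → Set} → Decidable P → Dec (∀ x → P x)
Π? {zero}  P? = map′ (λ { p [] → p }) (λ p → p []) (P? [])
Π? {suc n} P? = map′ (λ { (p , q) (false ∷ x) → p x ; (p , q) (true ∷ x) → q x })
  (λ p → p ∘ (false ∷_) , p ∘ (true ∷_))
  (Π? (P? ∘ (false ∷_)) ×-dec Π? (P? ∘ (true ∷_)))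

⊕-interchange : ∀ (w x y z : Vec Bool n) → (w ⊕ x) ⊕ (y ⊕ z) ≡ (w ⊕ y) ⊕ (x ⊕ z)
⊕-interchange []      []      []      []      = refl
⊕-interchange (a ∷ w) (b ∷ x) (c ∷ y) (d ∷ z) = cong₂ _∷_ (xor-interchange a b c d) (⊕-interchange w x y z)
  where
  open CommutativeSemigroup (CommutativeRing.+-commutativeSemigroup Bool.xor-∧-commutativeRing)
    using () renaming (interchange to xor-interchange)

⊕-self : ∀ (x : Vec Bool n) → x ⊕ x ≡ 𝟎
⊕-self []      = refl
⊕-self (a ∷ x) = cong₂ _∷_ (Bool.xor-same a) (⊕-self x)

⊕≡𝟎⇒≡ : ∀ (x y : Vec Bool n) → x ⊕ y ≡ 𝟎 → x ≡ y
⊕≡𝟎⇒≡ []          []          _  = refl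
⊕≡𝟎⇒≡ (false ∷ x) (false ∷ y) eq = cong (false ∷_) (⊕≡𝟎⇒≡ x y (Vec.∷-injectiveʳ eq))
⊕≡𝟎⇒≡ (true  ∷ x) (true  ∷ y) eq = cong (true ∷_) (⊕≡𝟎⇒≡ x y (Vec.∷-injectiveʳ eq))

combination-⊕ : ∀ (c : Vec Bool k) (as bs : Vec (Vec Bool n) k) →
  c · zipWith _⊕_ as bs ≡ c · as ⊕ c · bs
combination-⊕ []      []       []       = sym (⊕-self 𝟎)
combination-⊕ (x ∷ c) (a ∷ as) (b ∷ bs) = trans
  (cong₂ _⊕_ (scale-⊕ x a b) (combination-⊕ c as bs))
  (⊕-interchange (scaleᵛ 𝔽₂ x a) (scaleᵛ 𝔽₂ x b) (c · as) (c · bs))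
  where
  scale-⊕ : ∀ x (a b : Vec Bool n) → scaleᵛ 𝔽₂ x (a ⊕ b) ≡ scaleᵛ 𝔽₂ x a ⊕ scaleᵛ 𝔽₂ x b
  scale-⊕ x []      []      = refl
  scale-⊕ x (a ∷ as) (b ∷ bs) = cong₂ _∷_ (Bool.∧-distribˡ-xor x a b) (scale-⊕ x as bs)

-- Any failure would be a relation with coefficients (1,0), (0,1) or (1,1), the only nonzero ones
-- over 𝔽₂.
independent⇒distinct : ∀ {x y : Vec Bool n} → Independent 𝔽₂ (x ∷ y ∷ []) → x ≢ 𝟎 × y ≢ 𝟎 × x ≢ y
independent⇒distinct {x = x} {y} ind =
  (λ { refl → case-≢ (ind (true ∷ false ∷ []) (first y)) }) ,
  (λ { refl → case-≢ʳ (ind (false ∷ true ∷ []) (second x)) }) ,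
  (λ { refl → case-≢ (ind (true ∷ true ∷ []) (both x)) })
  where
  case-≢ : ∀ {b} → ¬ (Vec Bool 2 ∋ true ∷ b ∷ []) ≡ 𝟎
  case-≢ ()

  case-≢ʳ : ∀ {b} → ¬ (Vec Bool 2 ∋ b ∷ true ∷ []) ≡ 𝟎
  case-≢ʳ ()

  first : ∀ {n} (y : Vec Bool n) → (true ∷ false ∷ []) · (𝟎 ∷ y ∷ []) ≡ 𝟎
  first []      = refl
  first (_ ∷ y) = cong (false ∷_) (first y)

  second : ∀ {n} (x : Vec Bool n) → (false ∷ true ∷ []) · (x ∷ 𝟎 ∷ []) ≡ 𝟎
  second []      = refl
  second (_ ∷ x) = cong (false ∷_) (second x)

  both : ∀ {n} (x : Vec Bool n) → (true ∷ true ∷ []) · (x ∷ x ∷ []) ≡ 𝟎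
  both []          = refl
  both (false ∷ x) = cong (false ∷_) (both x)
  both (true  ∷ x) = cong (false ∷_) (both x)

-- Rank metric codes of 3 × n matrices.

identity : ∀ n → Vec (Vec Bool n) n
identity zero    = []
identity (suc n) = (true ∷ 𝟎) ∷ map (false ∷_) (identity n)

-- Multiplication by x on 𝔽₂[x] / (x^(n+1) + p), coefficients in order
-- of increasing degree.
companion : Vec Bool (suc n) → Vec (Vec Bool (suc n)) (suc n)
companion {n} p = map (false ∷_) (identity n) ∷ʳ p

-- If x generates a field of degree at least three, this has rank at least
-- two unless a = b = 0: for dependent a and b, the last row is outside
-- their span, as no nonzero combination of 1, x and x² vanishes.
pencil : Vec Bool (suc n) → Vec Bool (suc n) × Vec Bool (suc n) → Vec (Vec Bool (suc n)) 3
pencil p (a , b) = a ∷ b ∷ (a ⊕ b · companion p) · companion p ∷ []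

pencil-⊕ : ∀ (p : Vec Bool (suc n)) a b a′ b′ →
  pencil p (a ⊕ a′ , b ⊕ b′) ≡ zipWith _⊕_ (pencil p (a , b)) (pencil p (a′ , b′))
pencil-⊕ p a b a′ b′ = cong (λ r → a ⊕ a′ ∷ b ⊕ b′ ∷ r ∷ []) (begin
  (a ⊕ a′ ⊕ (b ⊕ b′) · X) · X         ≡⟨ cong (λ u → (a ⊕ a′ ⊕ u) · X) (combination-add 𝔽₂ b b′ X) ⟩
  (a ⊕ a′ ⊕ (b · X ⊕ b′ · X)) · X     ≡⟨ cong (_· X) (⊕-interchange a a′ (b · X) (b′ · X)) ⟩
  ((a ⊕ b · X) ⊕ (a′ ⊕ b′ · X)) · X   ≡⟨ combination-add 𝔽₂ (a ⊕ b · X) (a′ ⊕ b′ · X) X ⟩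
  (a ⊕ b · X) · X ⊕ (a′ ⊕ b′ · X) · X ∎)
  where
  open ≡-Reasoning
  X = companion p

-- The test on `c` precedes the quantifier over `d`, so a decision runs through `d` only for `c` in
-- the kernel.
SmallKernels : Vec Bool (suc n) → Set
SmallKernels {n} p = ∀ (a b : Vec Bool (suc n)) c → c ≢ 𝟎 → c · pencil p (a , b) ≡ 𝟎 →
  ∀ d → d ≢ 𝟎 × c ≢ d → d · pencil p (a , b) ≡ 𝟎 → a ≡ 𝟎 × b ≡ 𝟎

smallKernels? : Decidable (SmallKernels {n})
smallKernels? p = Π? λ a → Π? λ b → Π? λ c → ¬? (c ≟ 𝟎) →-dec (c · pencil p (a , b) ≟ 𝟎) →-dec
  Π? λ d → (¬? (d ≟ 𝟎) ×-dec ¬? (c ≟ d)) →-dec (d · pencil p (a , b) ≟ 𝟎) →-dec (a ≟ 𝟎 ×-dec b ≟ 𝟎)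

-- Pencils are additive: the difference of two codewords is again a codeword, and two independent
-- kernel vectors force it to vanish.
pencil-isRankCode : ∀ (p : Vec Bool (suc n)) → SmallKernels p → IsRankCode 𝔽₂ (pencil p)
pencil-isRankCode p small {a , b} {a′ , b′} c d ind eqᶜ eqᵈ =
  let c≢𝟎 , distinct = independent⇒distinct ind
      a≡ , b≡        = small (a ⊕ a′) (b ⊕ b′) c c≢𝟎 (difference c eqᶜ) d distinct (difference d eqᵈ)
  in cong₂ _,_ (⊕≡𝟎⇒≡ a a′ a≡) (⊕≡𝟎⇒≡ b b′ b≡)
  where
  open ≡-Reasoning
  difference : ∀ c → c · pencil p (a , b) ≡ c · pencil p (a′ , b′) →
               c · pencil p (a ⊕ a′ , b ⊕ b′) ≡ 𝟎
  difference c eq = begin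
    c · pencil p (a ⊕ a′ , b ⊕ b′)                                    ≡⟨ cong (c ·_) (pencil-⊕ p a b a′ b′) ⟩
    c · zipWith _⊕_ (pencil p (a , b)) (pencil p (a′ , b′))        ≡⟨ combination-⊕ c _ _ ⟩
    c · pencil p (a , b) ⊕ c · pencil p (a′ , b′)                  ≡⟨ cong (_⊕ c · pencil p (a′ , b′)) eq ⟩
    c · pencil p (a′ , b′) ⊕ c · pencil p (a′ , b′)                ≡⟨ ⊕-self _ ⟩
    𝟎                                                                    ∎

4^n≡2^n*2^n : ∀ n → 4 ^ n ≡ 2 ^ n * 2 ^ n
4^n≡2^n*2^n n = begin
  4 ^ n           ≡⟨ ℕ.^-*-assoc 2 2 n ⟩
  2 ^ (2 * n)     ≡⟨ cong (λ k → 2 ^ (n + k)) (ℕ.+-identityʳ n) ⟩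
  2 ^ (n + n)     ≡⟨ ℕ.^-distribˡ-+-* 2 n n ⟩
  2 ^ n * 2 ^ n   ∎
  where open ≡-Reasoning

-- For n ≥ 3 the size 4ⁿ is the Singleton bound for 3 × n matrices over 𝔽₂ at rank distance two.
record RankCode (n : ℕ) : Set₁ where
  field
    Index      : Set
    Index↔Fin  : Index ↔ Fin (4 ^ n)
    matrix     : Index → Vec (Vec Bool n) 3
    isRankCode : IsRankCode 𝔽₂ matrix

fieldCode : ∀ (p : Vec Bool (suc n)) → SmallKernels p → RankCode (suc n)
fieldCode {n} p small = record
  { Index      = Vec Bool (suc n) × Vec Bool (suc n)
  ; Index↔Fin  = subst (λ N → (Vec Bool (suc n) × Vec Bool (suc n)) ↔ Fin N) (sym (4^n≡2^n*2^n (suc n)))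
                   (↔-trans (vectors ×-↔ vectors) (↔-sym Fin.*↔×))
  ; matrix     = pencil p
  ; isRankCode = pencil-isRankCode p small
  }
  where
  vectors : Vec Bool (suc n) ↔ Fin (2 ^ suc n)
  vectors = Vec↔Fin (↔-sym Fin.2↔Bool) (suc n)

juxtaposeCodes : RankCode m → RankCode n → RankCode (m + n)
juxtaposeCodes {m} {n} C D = record
  { Index      = C.Index × D.Index
  ; Index↔Fin  = subst (λ N → (C.Index × D.Index) ↔ Fin N) (sym (ℕ.^-distribˡ-+-* 4 m n))
                   (↔-trans (C.Index↔Fin ×-↔ D.Index↔Fin) (↔-sym Fin.*↔×))
  ; matrix     = juxtapose 𝔽₂ C.matrix D.matrix
  ; isRankCode = juxtapose-isRankCode 𝔽₂ C.matrix D.matrix C.isRankCode D.isRankCode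
  }
  where
  module C = RankCode C
  module D = RankCode D

abstract
  -- The moduli here and in the next two codes are the irreducible polynomials x³ + x + 1, x⁴ + x +
  -- 1 and x⁵ + x² + 1.
  rankCode₃ : RankCode 3
  rankCode₃ = fieldCode _ (from-yes (smallKernels? (true ∷ true ∷ false ∷ [])))

  rankCode₄ : RankCode 4
  rankCode₄ = fieldCode _ (from-yes (smallKernels? (true ∷ true ∷ false ∷ false ∷ [])))

  rankCode₅ : RankCode 5
  rankCode₅ = fieldCode _ (from-yes (smallKernels? (true ∷ false ∷ true ∷ false ∷ false ∷ [])))

-- Every length from 3 on is 3, 4 or 5 plus a multiple of 3.
rankCode : ∀ n → RankCode (3 + n)
rankCode 0                   = rankCode₃
rankCode 1                   = rankCode₄
rankCode 2                   = rankCode₅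
rankCode (suc (suc (suc n))) = juxtaposeCodes rankCode₃ (rankCode n)

-- Powers of a field element and planes given by exponents.

-- Least significant bit first; higher bits are dropped, hence the round trip demanded in
-- `IsBinaryPlane`.
toBits : ∀ n → ℕ → Vec Bool n
toBits zero    _ = []
toBits (suc n) k = (k % 2 ≡ᵇ 1) ∷ toBits n (k ℕ./ 2)

fromBits : Vec Bool n → ℕ
fromBits []       = 0
fromBits (b ∷ bs) = (if b then suc else (λ k → k)) (fromBits bs * 2)

frobenius : ℕ → (Vec Bool 3 → ℕ) → Vec Bool 3 → ℕ
frobenius zero    e c = e c
frobenius (suc φ) e c = frobenius φ e c * 2

-- `X` stands for multiplication by x and `F` for squaring. The hypotheses are the matrix identity X
-- F = F X², that is (x v)² = x² v², and that the unit `u` is its own square.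
module Powers (u : Vec Bool n) (X F : Vec (Vec Bool n) n)
  (X² : map (_· F) X ≡ map (_· X) (map (_· X) F)) (u² : u · F ≡ u) where

  -- Abstract, to keep the conversion checker from computing large powers.
  abstract
    power : ℕ → Vec Bool n
    power zero    = u
    power (suc k) = power k · X

    power-zero : power 0 ≡ u
    power-zero = refl

    power-suc : ∀ k → power k · X ≡ power (suc k)
    power-suc _ = refl

  power-frobenius : ∀ k → power k · F ≡ power (k * 2)
  power-frobenius zero    = trans (cong (_· F) power-zero) (trans u² (sym power-zero))
  power-frobenius (suc k) = begin
    power (suc k) · F                     ≡⟨ cong (_· F) (power-suc k) ⟨
    power k · X · F                       ≡⟨ combination-combination 𝔽₂ (power k) X F ⟩
    power k · map (_· F) X                ≡⟨ cong (power k ·_) X² ⟩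
    power k · map (_· X) (map (_· X) F)   ≡⟨ combination-combination 𝔽₂ (power k) (map (_· X) F) X ⟨
    power k · map (_· X) F · X            ≡⟨ cong (_· X) (combination-combination 𝔽₂ (power k) F X) ⟨
    power k · F · X · X                   ≡⟨ cong (λ v → v · X · X) (power-frobenius k) ⟩
    power (k * 2) · X · X                 ≡⟨ cong (_· X) (power-suc (k * 2)) ⟩
    power (suc (k * 2)) · X               ≡⟨ power-suc (suc (k * 2)) ⟩
    power (suc k * 2)                     ∎
    where open ≡-Reasoning

  binaryPower : Vec Bool k → Vec Bool n
  binaryPower []       = u
  binaryPower (b ∷ bs) = (if b then _· X else (λ v → v)) (binaryPower bs · F)

  binaryPower-correct : ∀ (bs : Vec Bool k) → binaryPower bs ≡ power (fromBits bs)
  binaryPower-correct []           = sym power-zero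
  binaryPower-correct (false ∷ bs) = trans (cong (_· F) (binaryPower-correct bs)) (power-frobenius (fromBits bs))
  binaryPower-correct (true  ∷ bs) = trans
    (cong (_· X) (trans (cong (_· F) (binaryPower-correct bs)) (power-frobenius (fromBits bs))))
    (power-suc (fromBits bs * 2))

  private
    cong₃ : ∀ {x x′ y y′ z z′ : Vec Bool n} → x ≡ x′ → y ≡ y′ → z ≡ z′ →
            (Vec (Vec Bool n) 3 ∋ x ∷ y ∷ z ∷ []) ≡ x′ ∷ y′ ∷ z′ ∷ []
    cong₃ refl refl refl = refl

  planeBasis : (Vec Bool 3 → ℕ) → Vec (Vec Bool n) 3
  planeBasis e = power (e (true ∷ false ∷ false ∷ [])) ∷ power (e (false ∷ true ∷ false ∷ [])) ∷
                 power (e (false ∷ false ∷ true ∷ [])) ∷ []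

  -- `e` lists discrete logarithms of the seven points of the plane.
  IsPlane : (Vec Bool 3 → ℕ) → Set
  IsPlane e = ∀ c → c ≢ 𝟎 → c · planeBasis e ≡ power (e c)

  -- Linear maps preserve the relations among the points. It is applied to `X`, which adds one to
  -- exponents, and to `F`, which doubles them.
  isPlane-map : ∀ e (g : ℕ → ℕ) (M : Vec (Vec Bool n) n) → (∀ k → power k · M ≡ power (g k)) →
                IsPlane e → IsPlane (g ∘ e)
  isPlane-map e g M M≗g e-plane c c≢𝟎 = begin
    c · planeBasis (g ∘ e)           ≡⟨ cong (c ·_) (cong₃ (M≗g _) (M≗g _) (M≗g _)) ⟨
    c · map (_· M) (planeBasis e)    ≡⟨ combination-combination 𝔽₂ c (planeBasis e) M ⟨
    c · planeBasis e · M             ≡⟨ cong (_· M) (e-plane c c≢𝟎) ⟩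
    power (e c) · M                  ≡⟨ M≗g (e c) ⟩
    power (g (e c))                  ∎
    where open ≡-Reasoning

  isPlane-shift : ∀ e i → IsPlane e → IsPlane (λ c → i + e c)
  isPlane-shift e zero    e-plane = e-plane
  isPlane-shift e (suc i) e-plane = isPlane-map (λ c → i + e c) suc X power-suc (isPlane-shift e i e-plane)

  isPlane-frobenius : ∀ e φ → IsPlane e → IsPlane (frobenius φ e)
  isPlane-frobenius e zero    e-plane = e-plane
  isPlane-frobenius e (suc φ) e-plane = isPlane-map (frobenius φ e) (_* 2) F power-frobenius (isPlane-frobenius e φ e-plane)

  -- Square-and-multiply makes the hypothesis cheap to decide.
  IsBinaryPlane : ℕ → (Vec Bool 3 → ℕ) → Set
  IsBinaryPlane k e = ∀ c → c ≢ 𝟎 → fromBits (toBits k (e c)) ≡ e c ×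
    c · (p (true ∷ false ∷ false ∷ []) ∷ p (false ∷ true ∷ false ∷ []) ∷ p (false ∷ false ∷ true ∷ []) ∷ []) ≡ p c
    where
    p : Vec Bool 3 → Vec Bool n
    p = binaryPower ∘ toBits k ∘ e

  isBinaryPlane? : ∀ k → Decidable (IsBinaryPlane k)
  isBinaryPlane? k e = Π? λ c → ¬? (c ≟ 𝟎) →-dec (_ ℕ.≟ _) ×-dec (_ ≟ _)

  isBinaryPlane⇒isPlane : ∀ {k e} → IsBinaryPlane k e → IsPlane e
  isBinaryPlane⇒isPlane {k} {e} e-plane c c≢𝟎 = trans
    (cong (c ·_) (sym (cong₃ (correct _ λ ()) (correct _ λ ()) (correct _ λ ()))))
    (trans (proj₂ (e-plane c c≢𝟎)) (correct c c≢𝟎))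
    where
    correct : ∀ c → c ≢ 𝟎 → binaryPower (toBits k (e c)) ≡ power (e c)
    correct c c≢𝟎 = trans (binaryPower-correct (toBits k (e c))) (cong power (proj₁ (e-plane c c≢𝟎)))

-- Sequences of prime period.

-- The powers of x are abstracted to a sequence in which each value determines the next. The period
-- is `suc p`, so multiplication by `p` acts as negation.
module PrimePeriod {X : Set} (f : ℕ → X) (p : ℕ) (p-prime : Prime (suc p))
  (f-suc : ∀ {a b} → f a ≡ f b → f (suc a) ≡ f (suc b))
  (f-p≡f-0 : f (suc p) ≡ f 0) (f-1≢f-0 : f 1 ≢ f 0) where

  open ≡-Reasoning

  f-+ˡ : ∀ m {a b} → f a ≡ f b → f (m + a) ≡ f (m + b)
  f-+ˡ zero    eq = eq
  f-+ˡ (suc m) eq = f-suc (f-+ˡ m eq)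

  f-+ : ∀ {a a′ b b′} → f a ≡ f a′ → f b ≡ f b′ → f (a + b) ≡ f (a′ + b′)
  f-+ {a} {a′} {b} {b′} eqᵃ eqᵇ = begin
    f (a + b)   ≡⟨ f-+ˡ a eqᵇ ⟩
    f (a + b′)  ≡⟨ cong f (ℕ.+-comm a b′) ⟩
    f (b′ + a)  ≡⟨ f-+ˡ b′ eqᵃ ⟩
    f (b′ + a′) ≡⟨ cong f (ℕ.+-comm b′ a′) ⟩
    f (a′ + b′) ∎

  f-* : ∀ k {a b} → f a ≡ f b → f (k * a) ≡ f (k * b)
  f-* zero    eq = refl
  f-* (suc k) eq = f-+ eq (f-* k eq)

  f-periodic : ∀ {q} → f q ≡ f 0 → ∀ a k → f (a + k * q) ≡ f a
  f-periodic {q} eq a k = begin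
    f (a + k * q) ≡⟨ f-+ˡ a (f-* k eq) ⟩
    f (a + k * 0) ≡⟨ cong (λ z → f (a + z)) (ℕ.*-zeroʳ k) ⟩
    f (a + 0)     ≡⟨ cong f (ℕ.+-identityʳ a) ⟩
    f a           ∎

  -- Adding `m * p` completes the shift by `m` to a multiple of the period.
  f-cancelˡ : ∀ m {a b} → f (m + a) ≡ f (m + b) → f a ≡ f b
  f-cancelˡ m {a} {b} eq = begin
    f a                 ≡⟨ period a ⟨
    f (m * p + (m + a)) ≡⟨ f-+ˡ (m * p) eq ⟩
    f (m * p + (m + b)) ≡⟨ period b ⟩
    f b                 ∎
    where
    period : ∀ c → f (m * p + (m + c)) ≡ f c
    period c = trans
      (cong f (solve 3 (λ m p c → m :* p :+ (m :+ c) := c :+ m :* (con 1 :+ p)) refl m p c))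
      (f-periodic f-p≡f-0 c m)

  -- By Bézout, two coprime periods make 1 a period.
  f-1≡f-0 : ∀ {r} → Coprime (suc p) r → f r ≡ f 0 → f 1 ≡ f 0
  f-1≡f-0 {r} coprime eq with coprime-Bézout coprime
  ... | Bézout.+- x y 1+yr≡xp = begin
    f 1           ≡⟨ f-periodic eq 1 y ⟨
    f (1 + y * r) ≡⟨ cong f 1+yr≡xp ⟩
    f (x * suc p) ≡⟨ f-periodic f-p≡f-0 0 x ⟩
    f 0           ∎
  ... | Bézout.-+ x y 1+xp≡yr = begin
    f 1               ≡⟨ f-periodic f-p≡f-0 1 x ⟨
    f (1 + x * suc p) ≡⟨ cong f 1+xp≡yr ⟩
    f (y * r)         ≡⟨ f-periodic eq 0 y ⟩
    f 0               ∎

  -- A nonzero remainder modulo the prime `suc p` would be a period coprime to it.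
  f≡f-0⇒∣ : ∀ d → f d ≡ f 0 → suc p ∣ d
  f≡f-0⇒∣ d eq with d % suc p in d%p≡r | m%n<n d (suc p)
  ... | zero  | _   = m%n≡0⇒n∣m d (suc p) d%p≡r
  ... | suc r | r<p = contradiction (f-1≡f-0 (prime⇒coprime p-prime r<p) (begin
    f (suc r)                         ≡⟨ cong f d%p≡r ⟨
    f (d % suc p)                     ≡⟨ f-periodic f-p≡f-0 (d % suc p) (d ℕ./ suc p) ⟨
    f (d % suc p + d ℕ./ suc p * suc p) ≡⟨ cong f (m≡m%n+[m/n]*n d (suc p)) ⟨
    f d                               ≡⟨ eq ⟩
    f 0                               ∎)) f-1≢f-0

  private
    ordered : ∀ {a b} → a ≤ b → f a ≡ f b → a % suc p ≡ b % suc p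
    ordered {a} a≤b eq with d , refl ← ℕ.m≤n⇒∃[o]m+o≡n a≤b = sym (%-remove-+ʳ a
      (f≡f-0⇒∣ d (f-cancelˡ a (trans (sym eq) (cong f (sym (ℕ.+-identityʳ a)))))))

  f-injective : ∀ a b → f a ≡ f b → a % suc p ≡ b % suc p
  f-injective a b eq with ℕ.≤-total a b
  ... | inj₁ a≤b = ordered a≤b eq
  ... | inj₂ b≤a = sym (ordered b≤a (sym eq))

  -- Modulo p + 1 the number a + p b is a - b.
  f-differences : ∀ i a b j c d → f (i + a) ≡ f (j + c) → f (i + b) ≡ f (j + d) →
                  (a + p * b) % suc p ≡ (c + p * d) % suc p
  f-differences i a b j c d eq₁ eq₂ = f-injective (a + p * b) (c + p * d) (begin
    f (a + p * b)             ≡⟨ shift i a b ⟨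
    f (i + a + p * (i + b))   ≡⟨ f-+ eq₁ (f-* p eq₂) ⟩
    f (j + c + p * (j + d))   ≡⟨ shift j c d ⟩
    f (c + p * d)             ∎)
    where
    shift : ∀ i a b → f (i + a + p * (i + b)) ≡ f (a + p * b)
    shift i a b = trans
      (cong f (solve 4 (λ i a b p → i :+ a :+ p :* (i :+ b) := a :+ p :* b :+ i :* (con 1 :+ p)) refl i a b p))
      (f-periodic f-p≡f-0 (a + p * b) i)

-- Orbit representatives and the table of their differences.

Trie : Set → ℕ → Set
Trie A zero    = A
Trie A (suc n) = Trie A n × Trie A n

constant : ∀ {A} → A → ∀ n → Trie A n
constant a zero    = a
constant a (suc n) = constant a n , constant a n

find : ∀ {A} → Vec Bool n → Trie A n → A
find []           a       = a
find (false ∷ bs) (t , _) = find bs t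
find (true  ∷ bs) (_ , t) = find bs t

insert : ∀ {A} → Vec Bool n → A → Trie A n → Trie A n
insert []           a _       = a
insert (false ∷ bs) a (t , s) = insert bs a t , s
insert (true  ∷ bs) a (t , s) = t , insert bs a s

pointExponent : Vec ℕ 7 → Vec Bool 3 → ℕ
pointExponent (e₁ ∷ e₂ ∷ e₁₂ ∷ e₃ ∷ e₁₃ ∷ e₂₃ ∷ e₁₂₃ ∷ []) = λ where
  -- A default: the zero vector is no point and has no logarithm.
  (false ∷ false ∷ false ∷ []) → 0
  (true  ∷ false ∷ false ∷ []) → e₁
  (false ∷ true  ∷ false ∷ []) → e₂
  (true  ∷ true  ∷ false ∷ []) → e₁₂
  (false ∷ false ∷ true  ∷ []) → e₃
  (true  ∷ false ∷ true  ∷ []) → e₁₃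
  (false ∷ true  ∷ true  ∷ []) → e₂₃
  (true  ∷ true  ∷ true  ∷ []) → e₁₂₃

-- Exponents of the points of one plane per orbit, in the order fixed by
-- pointExponent.
orbitRepresentatives : Vec (Vec ℕ 7) 15
orbitRepresentatives =
  (0 ∷ 1 ∷ 7258 ∷ 1249 ∷ 8105 ∷ 5040 ∷ 7978 ∷ []) ∷
  (0 ∷ 7 ∷ 6681 ∷ 1857 ∷ 7259 ∷ 7381 ∷ 7908 ∷ []) ∷
  (0 ∷ 9 ∷ 7714 ∷ 1144 ∷ 1945 ∷ 8102 ∷ 6771 ∷ []) ∷
  (0 ∷ 11 ∷ 1941 ∷ 209 ∷ 3565 ∷ 6579 ∷ 2926 ∷ []) ∷
  (0 ∷ 12 ∷ 3696 ∷ 2181 ∷ 6673 ∷ 6965 ∷ 2519 ∷ []) ∷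
  (0 ∷ 13 ∷ 8110 ∷ 4821 ∷ 8052 ∷ 5178 ∷ 7823 ∷ []) ∷
  (0 ∷ 17 ∷ 5132 ∷ 291 ∷ 1199 ∷ 8057 ∷ 6266 ∷ []) ∷
  (0 ∷ 20 ∷ 3996 ∷ 1075 ∷ 7313 ∷ 4776 ∷ 3939 ∷ []) ∷
  (0 ∷ 21 ∷ 6087 ∷ 2900 ∷ 4915 ∷ 4226 ∷ 8008 ∷ []) ∷
  (0 ∷ 27 ∷ 3572 ∷ 1190 ∷ 6710 ∷ 4989 ∷ 5199 ∷ []) ∷
  (0 ∷ 30 ∷ 682 ∷ 141 ∷ 6256 ∷ 6406 ∷ 2024 ∷ []) ∷
  (0 ∷ 31 ∷ 1243 ∷ 814 ∷ 4434 ∷ 1161 ∷ 6254 ∷ []) ∷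
  (0 ∷ 37 ∷ 5396 ∷ 258 ∷ 6469 ∷ 2093 ∷ 4703 ∷ []) ∷
  (0 ∷ 115 ∷ 1272 ∷ 949 ∷ 4539 ∷ 4873 ∷ 1580 ∷ []) ∷
  (0 ∷ 119 ∷ 6670 ∷ 490 ∷ 6812 ∷ 7312 ∷ 5941 ∷ []) ∷ []

point : Fin 15 → Fin 13 → Vec Bool 3 → ℕ
point o φ = frobenius (toℕ φ) (pointExponent (lookup orbitRepresentatives o))

-- The difference of two exponents modulo 8191, as 8190 ≡ -1.
difference : Fin 15 → Fin 13 → Vec Bool 3 → Vec Bool 3 → ℕ
difference o φ c d = (point o φ c + 8190 * point o φ d) % 8191

-- What a difference has to reveal: the plane up to a shift, and the first point, whose exponent
-- then fixes the shift.
Flag : Set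
Flag = Fin 15 × Fin 13 × Vec Bool 3

-- With `Distinct` there are 15 · 13 · 42 = 8190 ordered pairs of points, as many as nonzero
-- residues modulo 8191.
Line : Set
Line = Fin 15 × Fin 13 × Vec Bool 3 × Vec Bool 3

Distinct : Vec Bool 3 × Vec Bool 3 → Set
Distinct (c , d) = c ≢ 𝟎 × d ≢ 𝟎 × c ≢ d

distinct? : Decidable Distinct
distinct? (c , d) = ¬? (c ≟ 𝟎) ×-dec ¬? (d ≟ 𝟎) ×-dec ¬? (c ≟ d)

vectors : Vec Bool 3 ↔ Fin 8
vectors = Vec↔Fin (↔-sym Fin.2↔Bool) 3

lines : List Line
lines = cartesianProduct (allFin 15) (cartesianProduct (allFin 13)
  (filter distinct? (cartesianProduct (elements vectors) (elements vectors))))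

decode : Trie Flag 13 → ℕ → Flag
decode t k = find (toBits 13 k) t

Decodes : Trie Flag 13 → Line → Set
Decodes t (o , φ , c , d) = decode t (difference o φ c d) ≡ (o , φ , c)

decodes? : ∀ t → Decidable (Decodes t)
decodes? t (o , φ , c , d) = ≡-dec Fin._≟_ (≡-dec Fin._≟_ _≟_) (decode t (difference o φ c d)) (o , φ , c)

-- Distinctness of the differences is checked through a left inverse, the
-- lookup in this table, so no property of insert is needed.
flags : Trie Flag 13
flags = foldr (λ (o , φ , c , d) → insert (toBits 13 (difference o φ c d)) (o , φ , c))
  (constant (zero , zero , 𝟎) 13) lines

abstract
  lines-decode : All (Decodes flags) lines
  lines-decode = toWitness {a? = All.all? (decodes? flags) lines} _

∈-lines : ∀ o φ c d → Distinct (c , d) → (o , φ , c , d) ∈ˡ lines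
∈-lines o φ c d distinct = ∈-cartesianProduct⁺ (∈-allFin o) (∈-cartesianProduct⁺ (∈-allFin φ)
  (∈-filter⁺ distinct? (∈-cartesianProduct⁺ (∈-elements vectors c) (∈-elements vectors d)) distinct))

abstract
  -- The abstract pair exposes only the decoding property, so that later proofs never unfold the
  -- table.
  decoder : ∃ λ (decode : ℕ → Flag) → ∀ o φ c d → Distinct (c , d) → decode (difference o φ c d) ≡ (o , φ , c)
  decoder = decode flags , λ o φ c d distinct → All.lookup {P = Decodes flags} lines-decode (∈-lines o φ c d distinct)

-- The field with 8192 elements.

-- The coefficients of the primitive polynomial x¹³ + x¹² + x¹⁰ + x⁹ + 1,
-- without the leading one.
modulus : Vec Bool 13
modulus = true ∷ false ∷ false ∷ false ∷ false ∷ false ∷ false ∷ false ∷ false ∷ true ∷ true ∷ false ∷ true ∷ []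

one : Vec Bool 13
one = true ∷ 𝟎

times-x : Vec (Vec Bool 13) 13
times-x = companion modulus

-- The matrix of the Frobenius automorphism, with rows x⁰, x², x⁴, ….
squaring : Vec (Vec Bool 13) 13
squaring = iterate (λ v → v · times-x · times-x) one 13

abstract
  times-x-squaring : map (_· squaring) times-x ≡ map (_· times-x) (map (_· times-x) squaring)
  times-x-squaring = toWitness
    {a? = Vec.≡-dec _≟_ (map (_· squaring) times-x) (map (_· times-x) (map (_· times-x) squaring))} _

  one-squaring : one · squaring ≡ one
  one-squaring = toWitness {a? = one · squaring ≟ one} _

module 𝔽₈₁₉₂ = Powers one times-x squaring times-x-squaring one-squaring

abstract
  orbitRepresentatives-arePlanes : ∀ o → 𝔽₈₁₉₂.IsPlane (pointExponent (lookup orbitRepresentatives o))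
  orbitRepresentatives-arePlanes o = 𝔽₈₁₉₂.isBinaryPlane⇒isPlane {13}
    (All.lookup
      (toWitness {a? = All.all? (λ o → 𝔽₈₁₉₂.isBinaryPlane? 13 (pointExponent (lookup orbitRepresentatives o)))
                                (allFin 15)} _)
      (∈-allFin o))

  -- 8191 has thirteen binary digits, all 1, so square-and-multiply needs thirteen rounds.
  power-8191 : 𝔽₈₁₉₂.power 8191 ≡ 𝔽₈₁₉₂.power 0
  power-8191 = begin
    𝔽₈₁₉₂.power 8191                            ≡⟨ cong 𝔽₈₁₉₂.power fromBits-ones ⟨
    𝔽₈₁₉₂.power (fromBits (replicate 13 true))  ≡⟨ 𝔽₈₁₉₂.binaryPower-correct (replicate 13 true) ⟨
    𝔽₈₁₉₂.binaryPower (replicate 13 true)       ≡⟨ toWitness {a? = 𝔽₈₁₉₂.binaryPower (replicate 13 true) ≟ one} _ ⟩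
    one                                         ≡⟨ 𝔽₈₁₉₂.power-zero ⟨
    𝔽₈₁₉₂.power 0                               ∎
    where
    open ≡-Reasoning
    fromBits-ones : fromBits (replicate 13 true) ≡ 8191
    fromBits-ones = refl

  8191-prime : Prime 8191
  8191-prime = from-yes (prime? 8191)

difference-injective : ∀ {o φ c d o′ φ′ c′ d′} → Distinct (c , d) → Distinct (c′ , d′) →
  difference o φ c d ≡ difference o′ φ′ c′ d′ → (Flag ∋ (o , φ , c)) ≡ (o′ , φ′ , c′)
difference-injective {o} {φ} {c} {d} {o′} {φ′} {c′} {d′} distinct distinct′ eq = begin
  o , φ , c                                  ≡⟨ proj₂ decoder o φ c d distinct ⟨
  proj₁ decoder (difference o φ c d)         ≡⟨ cong (proj₁ decoder) eq ⟩
  proj₁ decoder (difference o′ φ′ c′ d′)     ≡⟨ proj₂ decoder o′ φ′ c′ d′ distinct′ ⟩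
  o′ , φ′ , c′                               ∎
  where open ≡-Reasoning

power-cong-suc : ∀ {a b} → 𝔽₈₁₉₂.power a ≡ 𝔽₈₁₉₂.power b → 𝔽₈₁₉₂.power (suc a) ≡ 𝔽₈₁₉₂.power (suc b)
power-cong-suc {a} {b} eq = begin
  𝔽₈₁₉₂.power (suc a)       ≡⟨ 𝔽₈₁₉₂.power-suc a ⟨
  𝔽₈₁₉₂.power a · times-x   ≡⟨ cong (_· times-x) eq ⟩
  𝔽₈₁₉₂.power b · times-x   ≡⟨ 𝔽₈₁₉₂.power-suc b ⟩
  𝔽₈₁₉₂.power (suc b)       ∎
  where open ≡-Reasoning

power-1≢power-0 : 𝔽₈₁₉₂.power 1 ≢ 𝔽₈₁₉₂.power 0
power-1≢power-0 eq = toWitnessFalse {a? = one · times-x ≟ one} _ (begin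
  one · times-x             ≡⟨ cong (_· times-x) 𝔽₈₁₉₂.power-zero ⟨
  𝔽₈₁₉₂.power 0 · times-x   ≡⟨ 𝔽₈₁₉₂.power-suc 0 ⟩
  𝔽₈₁₉₂.power 1             ≡⟨ eq ⟩
  𝔽₈₁₉₂.power 0             ≡⟨ 𝔽₈₁₉₂.power-zero ⟩
  one                       ∎)
  where open ≡-Reasoning

module Cyclic = PrimePeriod 𝔽₈₁₉₂.power 8190 8191-prime power-cong-suc power-8191 power-1≢power-0

-- Multiplication by x fixes 𝟎, so a vanishing power would equal its successor; cancelling `k` gives
-- x = 1.
power≢𝟎 : ∀ k → 𝔽₈₁₉₂.power k ≢ 𝟎
power≢𝟎 k eq = power-1≢power-0 (Cyclic.f-cancelˡ k (begin
  𝔽₈₁₉₂.power (k + 1)       ≡⟨ cong 𝔽₈₁₉₂.power (ℕ.+-comm k 1) ⟩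
  𝔽₈₁₉₂.power (suc k)       ≡⟨ 𝔽₈₁₉₂.power-suc k ⟨
  𝔽₈₁₉₂.power k · times-x   ≡⟨ cong (_· times-x) eq ⟩
  𝟎 · times-x               ≡⟨ combination-0 𝔽₂ times-x ⟩
  𝟎                         ≡⟨ eq ⟨
  𝔽₈₁₉₂.power k             ≡⟨ cong 𝔽₈₁₉₂.power (ℕ.+-identityʳ k) ⟨
  𝔽₈₁₉₂.power (k + 0)       ∎))
  where open ≡-Reasoning

-- The Steiner system.

Plane : Set
Plane = Fin 15 × Fin 13 × Fin 8191

exponent : Plane → Vec Bool 3 → ℕ
exponent (o , φ , i) c = toℕ i + point o φ c

steiner : Plane → Vec (Vec Bool 13) 3
steiner U = 𝔽₈₁₉₂.planeBasis (exponent U)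

steiner-· : ∀ U c → c ≢ 𝟎 → c · steiner U ≡ 𝔽₈₁₉₂.power (exponent U c)
steiner-· (o , φ , i) = 𝔽₈₁₉₂.isPlane-shift (point o φ) (toℕ i)
  (𝔽₈₁₉₂.isPlane-frobenius (pointExponent (lookup orbitRepresentatives o)) (toℕ φ) (orbitRepresentatives-arePlanes o))

steiner-independent : ∀ U → Independent 𝔽₂ (steiner U)
steiner-independent U c eq = decidable-stable (c ≟ 𝟎) λ c≢𝟎 →
  power≢𝟎 (exponent U c) (trans (sym (steiner-· U c c≢𝟎)) eq)

-- The difference of the exponents of two common points is free of the shifts, so it can be decoded
-- to the same flag for both planes.
steiner-separated : ∀ {U W} c d c′ d′ → Independent 𝔽₂ (c ∷ d ∷ []) →
  c · steiner U ≡ c′ · steiner W → d · steiner U ≡ d′ · steiner W → U ≡ W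
steiner-separated {U@(o , φ , i)} {W@(o′ , φ′ , i′)} c d c′ d′ ind eqᶜ eqᵈ =
  conclude (difference-injective {o} {φ} {c} {d} {o′} {φ′} {c′} {d′} distinct distinct′ differences)
  where
  open ≡-Reasoning

  ind′ : Independent 𝔽₂ (c′ ∷ d′ ∷ [])
  -- The two common vectors are independent because they are so in `U`; hence their coordinates in
  -- `W` are too.
  ind′ = independent-map⁻ 𝔽₂ (subst (Independent 𝔽₂) (cong₂ (λ x y → x ∷ y ∷ []) eqᶜ eqᵈ)
    (independent-map⁺ 𝔽₂ (steiner-independent U) ind))

  distinct : Distinct (c , d)
  distinct = independent⇒distinct ind

  distinct′ : Distinct (c′ , d′)
  distinct′ = independent⇒distinct ind′

  powersᶜ : 𝔽₈₁₉₂.power (exponent U c) ≡ 𝔽₈₁₉₂.power (exponent W c′)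
  powersᶜ = trans (sym (steiner-· U c (proj₁ distinct))) (trans eqᶜ (steiner-· W c′ (proj₁ distinct′)))

  powersᵈ : 𝔽₈₁₉₂.power (exponent U d) ≡ 𝔽₈₁₉₂.power (exponent W d′)
  powersᵈ = trans (sym (steiner-· U d (proj₁ (proj₂ distinct)))) (trans eqᵈ (steiner-· W d′ (proj₁ (proj₂ distinct′))))

  differences : difference o φ c d ≡ difference o′ φ′ c′ d′
  differences = Cyclic.f-differences (toℕ i) (point o φ c) (point o φ d) (toℕ i′) (point o′ φ′ c′) (point o′ φ′ d′)
    powersᶜ powersᵈ

  conclude : (o , φ , c) ≡ (o′ , φ′ , c′) → U ≡ W
  -- With the same point `c` on the same representative, the shifts agree modulo 8191, and both are
  -- smaller.
  conclude refl = cong (λ i → o , φ , i) (Fin.toℕ-injective (begin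
    toℕ i           ≡⟨ m<n⇒m%n≡m (Fin.toℕ<n i) ⟨
    toℕ i % 8191    ≡⟨ Cyclic.f-injective (toℕ i) (toℕ i′) (Cyclic.f-cancelˡ (point o φ c) (begin
                         𝔽₈₁₉₂.power (point o φ c + toℕ i)    ≡⟨ cong 𝔽₈₁₉₂.power (ℕ.+-comm (point o φ c) (toℕ i)) ⟩
                         𝔽₈₁₉₂.power (exponent U c)           ≡⟨ powersᶜ ⟩
                         𝔽₈₁₉₂.power (exponent W c)           ≡⟨ cong 𝔽₈₁₉₂.power (ℕ.+-comm (toℕ i′) (point o φ c)) ⟩
                         𝔽₈₁₉₂.power (point o φ c + toℕ i′)   ∎)) ⟩
    toℕ i′ % 8191   ≡⟨ m<n⇒m%n≡m (Fin.toℕ<n i′) ⟩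
    toℕ i′          ∎))

steiner-isPacking : IsPacking 𝔽₂ steiner
steiner-isPacking = steiner-independent , steiner-separated

-- Rational arithmetic of the density.

*≤⇒≤÷ : ∀ p q r .{{q≢0 : ℚ.NonZero q}} → ℚ.Positive q → r ℚ.* q ℚ.≤ p → r ℚ.≤ p ÷ q
*≤⇒≤÷ p q r {{q≢0}} q>0 rq≤p = begin
  r                  ≡⟨ ℚ.*-identityʳ r ⟨
  r ℚ.* 1ℚ           ≡⟨ cong (r ℚ.*_) (ℚ.*-inverseʳ q) ⟨
  r ℚ.* (q ℚ.* q⁻¹)  ≡⟨ ℚ.*-assoc r q q⁻¹ ⟨
  r ℚ.* q ℚ.* q⁻¹    ≤⟨ ℚ.*-monoʳ-≤-nonNeg q⁻¹ {{ℚ.pos⇒nonNeg q⁻¹ {{ℚ.1/pos⇒pos q {{q>0}}}}}} rq≤p ⟩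
  p ℚ.* q⁻¹          ∎
  where
  open ℚ.≤-Reasoning
  q⁻¹ : ℚ
  q⁻¹ = ℚ.1/_ q {{q≢0}}

-- The left side has the shape to which `qBinomial 2 (v ∸ 3) 2` unfolds: denominators 2 - 1 and 4 -
-- 1, then the final `1ℚ`.
cross-multiplied : ∀ k l N x y a → k * (N * 3 + x * y) ≤ a * (suc l * 3) →
  (+ k / suc l) ℚ.* (+ N / 1 ℚ.+ (+ x / 1) ℚ.* ((+ y / 3) ℚ.* 1ℚ)) ℚ.≤ + a / 1
cross-multiplied k l N x y a ineq = ℚ.toℚᵘ-cancel-≤ (begin
  toℚᵘ (c ℚ.* (N₁ ℚ.+ x₁ ℚ.* (y₃ ℚ.* 1ℚ)))
    ≡⟨ cong (λ z → toℚᵘ (c ℚ.* (N₁ ℚ.+ x₁ ℚ.* z))) (ℚ.*-identityʳ y₃) ⟩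
  toℚᵘ (c ℚ.* (N₁ ℚ.+ x₁ ℚ.* y₃))
    ≃⟨ ℚ.toℚᵘ-homo-* c (N₁ ℚ.+ x₁ ℚ.* y₃) ⟩
  toℚᵘ c ℚᵘ.* toℚᵘ (N₁ ℚ.+ x₁ ℚ.* y₃)
    ≃⟨ ℚᵘ.*-congˡ {toℚᵘ c} (ℚᵘ.≃-trans (ℚ.toℚᵘ-homo-+ N₁ (x₁ ℚ.* y₃))
         (ℚᵘ.+-congʳ (toℚᵘ N₁) (ℚ.toℚᵘ-homo-* x₁ y₃))) ⟩
  toℚᵘ c ℚᵘ.* (toℚᵘ N₁ ℚᵘ.+ toℚᵘ x₁ ℚᵘ.* toℚᵘ y₃)
    ≃⟨ ℚᵘ.*-cong (ℚ.toℚᵘ-fromℚᵘ (mkℚᵘ (+ k) l)) (ℚᵘ.+-cong (ℚ.toℚᵘ-fromℚᵘ (mkℚᵘ (+ N) 0))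
         (ℚᵘ.*-cong (ℚ.toℚᵘ-fromℚᵘ (mkℚᵘ (+ x) 0)) (ℚ.toℚᵘ-fromℚᵘ (mkℚᵘ (+ y) 2)))) ⟩
  mkℚᵘ (+ k) l ℚᵘ.* (mkℚᵘ (+ N) 0 ℚᵘ.+ mkℚᵘ (+ x) 0 ℚᵘ.* mkℚᵘ (+ y) 2)
    ≤⟨ *≤* integral ⟩
  mkℚᵘ (+ a) 0
    ≃⟨ ℚ.toℚᵘ-fromℚᵘ (mkℚᵘ (+ a) 0) ⟨
  toℚᵘ (+ a / 1) ∎)
  where
  open ℚᵘ.≤-Reasoning
  c = + k / suc l
  N₁ = + N / 1
  x₁ = + x / 1
  y₃ = + y / 3

  integral : (+ k ℤ.* (+ N ℤ.* + 3 ℤ.+ (+ x ℤ.* + y) ℤ.* + 1)) ℤ.* + 1 ℤ.≤ + a ℤ.* + (suc l * 3)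
  integral = subst₂ ℤ._≤_ lhs (ℤ.pos-* a (suc l * 3)) (ℤ.+≤+ ineq)
    where
    lhs : + (k * (N * 3 + x * y)) ≡ (+ k ℤ.* (+ N ℤ.* + 3 ℤ.+ (+ x ℤ.* + y) ℤ.* + 1)) ℤ.* + 1
    lhs = trans (ℤ.pos-* k (N * 3 + x * y)) (trans
      (cong (+ k ℤ.*_) (trans (ℤ.pos-+ (N * 3) (x * y))
        (cong₂ ℤ._+_ (ℤ.pos-* N 3) (trans (ℤ.pos-* x y) (sym (ℤ.*-identityʳ (+ x ℤ.* + y)))))))
      (sym (ℤ.*-identityʳ _)))

-- Applied with t = 2^(v-19), N = 2^(2v-6), x = 2^(v-4) - 1 and
-- y = 2^(v-3) - 1, so that x (y / 3) is the q-binomial coefficient.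
density : ∀ t N x y a → N ≡ 2 ^ 32 * (t * t) → x ≤ 2 ^ 15 * t → y ≤ 2 ^ 16 * t →
  1597245 * (2 ^ 12 * (t * t)) ≤ a →
  (+ 13056 / 10000) ℚ.* (+ N / 1 ℚ.+ (+ x / 1) ℚ.* ((+ y / 3) ℚ.* 1ℚ)) ℚ.≤ + a / 1
density t _ x y a refl x≤ y≤ a≥ = cross-multiplied 13056 9999 (2 ^ 32 * (t * t)) x y a (begin
  13056 * (2 ^ 32 * (t * t) * 3 + x * y)
    ≤⟨ ℕ.*-monoʳ-≤ 13056 (ℕ.+-monoʳ-≤ (2 ^ 32 * (t * t) * 3) (ℕ.*-mono-≤ x≤ y≤)) ⟩
  13056 * (2 ^ 32 * (t * t) * 3 + 2 ^ 15 * t * (2 ^ 16 * t))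
    ≡⟨ collect 13056 (2 ^ 32) 3 (2 ^ 15) (2 ^ 16) t ⟩
  13056 * (2 ^ 32 * 3 + 2 ^ 15 * 2 ^ 16) * (t * t)
    -- The numerical core 1.3056 · 7 · 2³¹ ≤ 3 · 1597245 · 2¹², checked by evaluation.
    ≤⟨ ℕ.*-monoˡ-≤ (t * t) (ℕ.≤ᵇ⇒≤ (13056 * (2 ^ 32 * 3 + 2 ^ 15 * 2 ^ 16)) (1597245 * 2 ^ 12 * (10000 * 3)) _) ⟩
  1597245 * 2 ^ 12 * (10000 * 3) * (t * t)
    ≡⟨ rearrange 1597245 (2 ^ 12) (10000 * 3) (t * t) ⟩
  1597245 * (2 ^ 12 * (t * t)) * (10000 * 3)
    ≤⟨ ℕ.*-monoˡ-≤ (10000 * 3) a≥ ⟩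
  a * (10000 * 3) ∎)
  where
  open ℕ.≤-Reasoning
  collect : ∀ k a b c d t → k * (a * (t * t) * b + c * t * (d * t)) ≡ k * (a * b + c * d) * (t * t)
  collect = solve 6 (λ k a b c d t → k :* (a :* (t :* t) :* b :+ c :* t :* (d :* t)) :=
    k :* (a :* b :+ c :* d) :* (t :* t)) refl

  rearrange : ∀ a b c d → a * b * c * d ≡ a * (b * d) * c
  rearrange = solve 4 (λ a b c d → a :* b :* c :* d := a :* (b :* d) :* c) refl

-- The lifted code and the bound.

liftedSteiner : ∀ n → Code 𝔽₂ (16 + n) 4 3 (15 * (13 * 8191) * 4 ^ (3 + n))
-- `k = 1` gives dimension 3 and distance 3 + 3 - 2 = 4; the matrices have 3 + n columns.
liftedSteiner n = packing⇒code 𝔽₂ {k = 1} (↔-trans (Plane↔Fin ×-↔ Index↔Fin) (↔-sym Fin.*↔×))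
  (juxtapose-isPacking 𝔽₂ steiner matrix steiner-isPacking isRankCode)
  where
  open RankCode (rankCode n)

  Plane↔Fin : Plane ↔ Fin (15 * (13 * 8191))
  Plane↔Fin = ↔-trans (↔-refl ×-↔ ↔-sym Fin.*↔×) (↔-sym Fin.*↔×)

A-lowerBound : ∀ m → 1597245 * (2 ^ 12 * (2 ^ m * 2 ^ m)) ≤ A 𝔽₂ (19 + m) 4 3
A-lowerBound m = begin
  1597245 * (2 ^ 12 * (2 ^ m * 2 ^ m))     ≡⟨ cong (λ z → 1597245 * (2 ^ 12 * z)) (4^n≡2^n*2^n m) ⟨
  1597245 * (4 ^ 6 * 4 ^ m)                ≡⟨ cong (1597245 *_) (ℕ.^-distribˡ-+-* 4 6 m) ⟨
  15 * (13 * 8191) * 4 ^ (6 + m)           ≤⟨ proj₂ (A-isMaximum 𝔽₂ (19 + m) 4 3) (liftedSteiner (3 + m)) ⟩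
  A 𝔽₂ (19 + m) 4 3                        ∎
  where open ℕ.≤-Reasoning

Bound : ℕ → Set
Bound v = (+ 13056 / 10000) ℚ.* (+ (2 ^ (2 * v ∸ 6)) / 1 ℚ.+ qBinomial 2 (v ∸ 3) 2) ℚ.≤ + A 𝔽₂ v 4 3 / 1

-- Keeping `v` a variable, tied to `m` by an equation, leaves the powers of two in `bound` stuck
-- instead of unfolding.
exponents : ∀ {v} m → 19 + m ≡ v →
  2 * v ∸ 6 ≡ 32 + (m + m) × v ∸ 3 + 1 ∸ 2 ≡ 15 + m × v ∸ 3 + 2 ∸ 2 ≡ 16 + m
exponents m refl =
  cong (_∸ 6) (solve 1 (λ m → con 2 :* (con 19 :+ m) := con 38 :+ (m :+ m)) refl m) ,
  cong (λ k → 14 + k) (ℕ.+-comm m 1) ,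
  cong (λ k → 14 + k) (ℕ.+-comm m 2)

bound : ∀ v m → 19 + m ≡ v → Bound v
bound v m eq = density (2 ^ m)
  (2 ^ (2 * v ∸ 6)) (2 ^ (v ∸ 3 + 1 ∸ 2) ∸ 1) (2 ^ (v ∸ 3 + 2 ∸ 2) ∸ 1) (A 𝔽₂ v 4 3)
    (power 32 (proj₁ (exponents m eq)))
    (factor 15 (proj₁ (proj₂ (exponents m eq))))
    (factor 16 (proj₂ (proj₂ (exponents m eq))))
    (subst (λ v → 1597245 * (2 ^ 12 * (2 ^ m * 2 ^ m)) ≤ A 𝔽₂ v 4 3) eq (A-lowerBound m))
  where
  power : ∀ b {k} → k ≡ b + (m + m) → 2 ^ k ≡ 2 ^ b * (2 ^ m * 2 ^ m)
  power b refl = trans (ℕ.^-distribˡ-+-* 2 b (m + m)) (cong (2 ^ b *_) (ℕ.^-distribˡ-+-* 2 m m))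

  factor : ∀ b {k} → k ≡ b + m → 2 ^ k ∸ 1 ≤ 2 ^ b * 2 ^ m
  factor b {k} eq = ℕ.≤-trans (ℕ.m∸n≤m (2 ^ k) 1) (ℕ.≤-reflexive (trans (cong (2 ^_) eq) (ℕ.^-distribˡ-+-* 2 b m)))

denominator-positive : ∀ v → ℚ.Positive ((+ (2 ^ (2 * v ∸ 6))) / 1 ℚ.+ qBinomial 2 (v ∸ 3) 2)
denominator-positive v = ℚ.pos+nonNeg⇒pos (+ N / 1) {{ℚ.normalize-pos N 1 {{_}} {{ℕ.m^n≢0 2 (2 * v ∸ 6)}}}}
  (qBinomial 2 (v ∸ 3) 2) {{qBinomial-nonNegative 2 (v ∸ 3) 2}}
  where
  N = 2 ^ (2 * v ∸ 6)

proposition11 : (v : ℕ) → 19 ≤ v →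
    _÷_ (+ A 𝔽₂ v 4 3 / 1)
    (+ (2 ^ (2 * v ∸ 6)) / 1 ℚ.+ qBinomial 2 (v ∸ 3) 2)
    {{denominator-nonZero v}}
    ℚ.≥ + 13056 / 10000
proposition11 v 19≤v = *≤⇒≤÷ (+ A 𝔽₂ v 4 3 / 1) _ (+ 13056 / 10000) {{denominator-nonZero v}} (denominator-positive v)
  (bound v (proj₁ (ℕ.m≤n⇒∃[o]m+o≡n 19≤v)) (proj₂ (ℕ.m≤n⇒∃[o]m+o≡n 19≤v)))
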